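{- A directed graph $G=(V,E)$ satisfies property (P1) if and only if $G$ does not contain a subgraph that is a subdivision of the directed graph $W$.
   Context: All graphs are simple. A directed graph $G$ is a directed $s$-$t$-series-parallel graph ($s$-$t$-DSP) iff it is a single edge $st$, or it arises from the disjoint union of a directed $s_1$-$t_1$-series-parallel graph $G_1$ and a directed $s_2$-$t_2$-series-parallel graph $G_2$ by one of: (P-composition) identify $s_1$ with $s_2$ and $t_1$ with $t_2$, then $s=s_1,t=t_1$; (S-composition) identify $t_1$ with $s_2$, then $s=s_1,t=t_2$. For vertices $u,v$ of $G$, $P_G(u,v)$ denotes the subgraph of $G$ induced by the edges lying on directed $u$-$v$-paths (paths have no repeated vertices). Property (P1): for every $(s,t)\in V^2$, $P_G(s,t)$ is either an $s$-$t$-DSP or contains no edges. $W$ is the directed graph with vertices $a,b,c,d$ and edges $ab, ac, bd, cd, bc$. A subdivision of $W$ is obtained by replacing each edge $xy$ of $W$ by a directed $x$-$y$-path of length at least $1$, these paths being internally vertex-disjoint. -}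

module Defs where

open import Data.Nat using (ℕ)
open import Data.Fin using (Fin)
open import Data.Bool using (Bool; true; false)
open import Data.List using (List; []; _∷_)
open import Data.List.Membership.Propositional using (_∈_)
open import Data.List.Relation.Unary.Unique.Propositional using (Unique)
open import Data.Product using (Σ; ∃; _×_; _,_)
open import Data.Sum using (_⊎_)
open import Data.Empty using (⊥)
open import Relation.Nullary using (¬_)
open import Relation.Binary.PropositionalEquality using (_≡_; _≢_)
open import Function.Bundles using (_⇔_)

-- A finite simple directed graph on vertex set Fin n is given by its
-- (decidable) edge relation E : Fin n → Fin n → Bool; simplicity (no loops)
-- is the hypothesis  ∀ x → E x x ≡ false ; multi-edges cannot occur.

-- An edge set (subgraph, given by its edges) on Fin n.
ERel : ℕ → Set₁
ERel n = Fin n → Fin n → Set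

module _ {n : ℕ} where

  Vtx : ERel n → Fin n → Set
  Vtx H x = ∃ λ y → H x y ⊎ H y x

  -- H is (the edge set of) a directed s-t-series-parallel graph.
  -- The two graphs of a composition are realised as edge-disjoint subgraphs
  -- whose vertex sets meet exactly in the identified vertices.
  data DSP : ERel n → Fin n → Fin n → Set₁ where
    single : ∀ {H s t} → s ≢ t →
             (∀ x y → H x y ⇔ (x ≡ s × y ≡ t)) → DSP H s t
    par    : ∀ {H s t} (H₁ H₂ : ERel n) → DSP H₁ s t → DSP H₂ s t →
             (∀ x y → H x y ⇔ (H₁ x y ⊎ H₂ x y)) →
             (∀ x y → H₁ x y → ¬ H₂ x y) →
             (∀ x → Vtx H₁ x → Vtx H₂ x → x ≡ s ⊎ x ≡ t) →
             DSP H s t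
    ser    : ∀ {H s t} (m : Fin n) (H₁ H₂ : ERel n) → DSP H₁ s m → DSP H₂ m t →
             (∀ x y → H x y ⇔ (H₁ x y ⊎ H₂ x y)) →
             (∀ x → Vtx H₁ x → Vtx H₂ x → x ≡ m) →
             DSP H s t

  data Walk (E : Fin n → Fin n → Bool) : List (Fin n) → Fin n → Fin n → Set where
    one  : ∀ u → Walk E (u ∷ []) u u
    cons : ∀ {u w v xs} → E u w ≡ true → Walk E (w ∷ xs) w v →
           Walk E (u ∷ w ∷ xs) u v

  Path : (Fin n → Fin n → Bool) → List (Fin n) → Fin n → Fin n → Set
  Path E xs u v = Walk E xs u v × Unique xs

  data Consec (x y : Fin n) : List (Fin n) → Set where
    here  : ∀ {xs} → Consec x y (x ∷ y ∷ xs)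
    there : ∀ {z xs} → Consec x y xs → Consec x y (z ∷ xs)

  PG : (Fin n → Fin n → Bool) → Fin n → Fin n → ERel n
  PG E u v x y = ∃ λ xs → Path E xs u v × Consec x y xs

  P1 : (Fin n → Fin n → Bool) → Set₁
  P1 E = ∀ s t → DSP (PG E s t) s t ⊎ (∀ x y → ¬ PG E s t x y)

data WV : Set where
  a b c d : WV

data WE : Set where
  ab ac bd cd bc : WE

tail : WE → WV
tail ab = a
tail ac = a
tail bd = b
tail cd = c
tail bc = b

head : WE → WV
head ab = b
head ac = c
head bd = d
head cd = d
head bc = c

module _ {n : ℕ} where

  Internal : Fin n → List (Fin n) → Fin n → Fin n → Set
  Internal x xs u v = x ∈ xs × x ≢ u × x ≢ v

  record WSubdivision (E : Fin n → Fin n → Bool) : Set where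
    field
      branch   : WV → Fin n
      injective : ∀ p q → branch p ≡ branch q → p ≡ q
      path     : WE → List (Fin n)
      isPath   : ∀ e → Path E (path e) (branch (tail e)) (branch (head e))
      disjoint : ∀ e e' → e ≢ e' → ∀ x →
                 Internal x (path e) (branch (tail e)) (branch (head e)) →
                 ¬ (x ∈ path e')

{-# OPTIONS --safe #-}

-- If a series-parallel graph from a to d contained a subdivision of W with source a
-- and sink d, then a P-composition would have the whole subdivision in one part,
-- because W minus a and d is connected, while in an S-composition both routes
-- a-b-d and a-c-d would have to use the identified vertex.
--
-- Conversely, let H be a series-parallel s-t-subgraph of E and follow an s-t-path p
-- through it. A piece of p that leaves H at u and returns at v is an ear. By induction
-- on H, adding the ear to H gives a series-parallel graph or a subdivision of W, unless
-- H has a path from v to u. In this last case p never again leaves the set of vertices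
-- below u, because p has already blocked the part of H leading from s to u; but t is
-- not in this set. Hence in a W-free graph all s-t-paths can be absorbed one by one,
-- starting from the series-parallel graph of a single path.
module Submission where

open import Defs
open import Data.Nat using (ℕ; zero; suc; _≤_; s≤s)
open import Data.Fin using (Fin; zero; suc)
open import Data.Fin.Properties using (_≟_; any?; injective⇒≤)
import Data.Bool as Bool
open import Data.Bool using (Bool; true; false)
open import Data.Empty using (⊥; ⊥-elim)
open import Data.List using (List; []; _∷_; _++_; drop; length; lookup; allFin; cartesianProductWith)
open import Data.List.Membership.Propositional using (_∈_; _∉_; lose)
open import Data.List.Membership.Propositional.Properties using (∈-++⁻; ∈-lookup; ∈-allFin; ∈-cartesianProductWith⁺)
open import Data.List.Relation.Unary.All using ([]; _∷_)
open import Data.List.Relation.Unary.AllPairs using ([]; _∷_)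
open import Data.List.Relation.Unary.Any as Any using (here; there; satisfied)
open import Data.List.Relation.Unary.Unique.Propositional using (Unique)
open import Data.List.Relation.Unary.Unique.DecPropositional using (unique?)
open import Data.List.Relation.Unary.Unique.Propositional.Properties using (++⁺; drop⁺; Unique[x∷xs]⇒x∉xs)
open import Data.Product using (Σ; ∃; _×_; _,_; proj₁; proj₂)
open import Data.Sum as Sum using (_⊎_; inj₁; inj₂; [_,_]′; swap)
open import Function using (_∘_; id)
open import Function.Bundles using (_⇔_; mk⇔; Equivalence)
open import Relation.Nullary using (¬_; Dec; yes; no)
open import Relation.Nullary.Decidable as Dec using (_×-dec_; _⊎-dec_)
open import Relation.Unary using (U; ∁)
open import Relation.Binary.PropositionalEquality using (_≡_; _≢_; refl; sym; cong; subst; trans; ≢-sym)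

open Equivalence using (to; from)

module _ {n : ℕ} where

  -- Edge sets, their unions and their vertices.

  infix 4 _⊑_ _≐_
  infixl 6 _∪_

  _⊑_ _≐_ : ERel n → ERel n → Set
  H ⊑ K = ∀ x y → H x y → K x y
  H ≐ K = ∀ x y → H x y ⇔ K x y

  _∪_ : ERel n → ERel n → ERel n
  (H ∪ K) x y = H x y ⊎ K x y

  ⟨_,_⟩ : Fin n → Fin n → ERel n
  ⟨ u , v ⟩ x y = x ≡ u × y ≡ v

  edges : (Fin n → Fin n → Bool) → ERel n
  edges E x y = E x y ≡ true

  Disjoint : ERel n → ERel n → Set
  Disjoint H K = ∀ x y → H x y → ¬ K x y

  MeetAt : ERel n → ERel n → Fin n → Set
  MeetAt H K m = ∀ x → Vtx H x → Vtx K x → x ≡ m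

  MeetAt₂ : ERel n → ERel n → Fin n → Fin n → Set
  MeetAt₂ H K u v = ∀ x → Vtx H x → Vtx K x → x ≡ u ⊎ x ≡ v

  variable
    H H₁ H₂ K Q : ERel n
    P P′ : Fin n → Set
    m r s t u v w x y : Fin n
    E : Fin n → Fin n → Bool
    xs ys zs : List (Fin n)

  pattern tail-of h = _ , inj₁ h
  pattern head-of h = _ , inj₂ h

  ∪-swap : H ≐ H₁ ∪ H₂ → H ≐ H₂ ∪ H₁
  ∪-swap e x y = mk⇔ (swap ∘ to (e x y)) (from (e x y) ∘ swap)

  ∪-left : H ≐ H₁ ∪ H₂ → H₁ ⊑ H
  ∪-left e x y h = from (e x y) (inj₁ h)

  ∪-right : H ≐ H₁ ∪ H₂ → H₂ ⊑ H
  ∪-right e x y h = from (e x y) (inj₂ h)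

  meetAt₂-sym : MeetAt₂ H K s t → MeetAt₂ K H s t
  meetAt₂-sym mt x i j = mt x j i

  vtx-mono : H ⊑ K → Vtx H x → Vtx K x
  vtx-mono i (y , inj₁ h) = y , inj₁ (i _ _ h)
  vtx-mono i (y , inj₂ h) = y , inj₂ (i _ _ h)

  ⊑-trans : H ⊑ K → K ⊑ Q → H ⊑ Q
  ⊑-trans i j x y h = j x y (i x y h)

  vtx-∪ : Vtx (H ∪ K) x → Vtx H x ⊎ Vtx K x
  vtx-∪ (y , inj₁ (inj₁ h)) = inj₁ (y , inj₁ h)
  vtx-∪ (y , inj₁ (inj₂ h)) = inj₂ (y , inj₁ h)
  vtx-∪ (y , inj₂ (inj₁ h)) = inj₁ (y , inj₂ h)
  vtx-∪ (y , inj₂ (inj₂ h)) = inj₂ (y , inj₂ h)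

  vtx-split : H ≐ H₁ ∪ H₂ → Vtx H x → Vtx H₁ x ⊎ Vtx H₂ x
  vtx-split {H₁ = H₁} {H₂ = H₂} e i =
    vtx-∪ {H = H₁} {K = H₂} (vtx-mono (λ x y → to (e x y)) i)

  vtxˡ : H ≐ H₁ ∪ H₂ → Vtx H₁ x → Vtx H x
  vtxˡ e = vtx-mono (∪-left e)

  vtxʳ : H ≐ H₁ ∪ H₂ → Vtx H₂ x → Vtx H x
  vtxʳ e = vtx-mono (∪-right e)

  single-vtx : Vtx ⟨ u , v ⟩ x → x ≡ u ⊎ x ≡ v
  single-vtx (tail-of (p , _)) = inj₁ p
  single-vtx (head-of (_ , p)) = inj₂ p

  -- Sources, sinks and decidability in series-parallel graphs.

  DSP-resp : H ≐ K → DSP K s t → DSP H s t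
  DSP-resp f (single ne e) = single ne λ x y →
    mk⇔ (to (e x y) ∘ to (f x y)) (from (f x y) ∘ from (e x y))
  DSP-resp f (par H₁ H₂ D₁ D₂ e dj mt) = par H₁ H₂ D₁ D₂
    (λ x y → mk⇔ (to (e x y) ∘ to (f x y)) (from (f x y) ∘ from (e x y))) dj mt
  DSP-resp f (ser m H₁ H₂ D₁ D₂ e mt) = ser m H₁ H₂ D₁ D₂
    (λ x y → mk⇔ (to (e x y) ∘ to (f x y)) (from (f x y) ∘ from (e x y))) mt

  edgeDSP : u ≢ v → DSP ⟨ u , v ⟩ u v
  edgeDSP ne = single ne λ _ _ → mk⇔ id id

  parDSP : DSP H s t → DSP K s t → Disjoint H K → MeetAt₂ H K s t → DSP (H ∪ K) s t
  parDSP D D′ = par _ _ D D′ (λ _ _ → mk⇔ id id)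

  serDSP : DSP H s m → DSP K m t → MeetAt H K m → DSP (H ∪ K) s t
  serDSP D D′ = ser _ _ _ D D′ (λ _ _ → mk⇔ id id)

  source-vtx : DSP H s t → Vtx H s
  source-vtx (single _ e) = tail-of (from (e _ _) (refl , refl))
  source-vtx (par _ _ D₁ _ e _ _) = vtxˡ e (source-vtx D₁)
  source-vtx (ser _ _ _ D₁ _ e _) = vtxˡ e (source-vtx D₁)

  sink-vtx : DSP H s t → Vtx H t
  sink-vtx (single _ e) = head-of (from (e _ _) (refl , refl))
  sink-vtx (par _ _ D₁ _ e _ _) = vtxˡ e (sink-vtx D₁)
  sink-vtx (ser _ _ _ _ D₂ e _) = vtxʳ e (sink-vtx D₂)

  source≢sink : DSP H s t → s ≢ t
  source≢sink (single ne _) = ne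
  source≢sink (par _ _ D₁ _ _ _ _) = source≢sink D₁
  source≢sink (ser _ _ _ D₁ D₂ _ mt) refl =
    source≢sink D₁ (mt _ (source-vtx D₁) (sink-vtx D₂))

  no-in-source : DSP H s t → ¬ H x s
  no-in-source (single ne e) h = ne (proj₂ (to (e _ _) h))
  no-in-source (par _ _ D₁ D₂ e _ _) h =
    [ no-in-source D₁ , no-in-source D₂ ]′ (to (e _ _) h)
  no-in-source (ser _ _ _ D₁ D₂ e mt) h with to (e _ _) h
  ... | inj₁ h₁ = no-in-source D₁ h₁
  ... | inj₂ h₂ = source≢sink D₁ (mt _ (source-vtx D₁) (head-of h₂))

  no-out-sink : DSP H s t → ¬ H t x
  no-out-sink (single ne e) h = ne (sym (proj₁ (to (e _ _) h)))
  no-out-sink (par _ _ D₁ D₂ e _ _) h =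
    [ no-out-sink D₁ , no-out-sink D₂ ]′ (to (e _ _) h)
  no-out-sink (ser _ _ _ D₁ D₂ e mt) h with to (e _ _) h
  ... | inj₁ h₁ = source≢sink D₂ (sym (mt _ (tail-of h₁) (sink-vtx D₂)))
  ... | inj₂ h₂ = no-out-sink D₂ h₂

  -- Edge sets are arbitrary relations, but a derivation bottoms out in single edges and so decides
  -- them. `follow` and `stuck` use this to see where a path leaves the graph.
  edge? : DSP H s t → ∀ x y → Dec (H x y)
  edge? (single {s = s} {t = t} _ e) x y =
    Dec.map′ (from (e x y)) (to (e x y)) ((x ≟ s) ×-dec (y ≟ t))
  edge? (par _ _ D₁ D₂ e _ _) x y =
    Dec.map′ (from (e x y)) (to (e x y)) (edge? D₁ x y ⊎-dec edge? D₂ x y)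
  edge? (ser _ _ _ D₁ D₂ e _) x y =
    Dec.map′ (from (e x y)) (to (e x y)) (edge? D₁ x y ⊎-dec edge? D₂ x y)

  vtx? : DSP H s t → ∀ x → Dec (Vtx H x)
  vtx? D x = any? λ y → edge? D x y ⊎-dec edge? D y x

  -- Walks inside an edge set and their confinement to one factor.

  -- Every vertex of the walk except possibly the last one satisfies P.
  data Reach (H : ERel n) (P : Fin n → Set) : Fin n → Fin n → Set where
    nil  : Reach H P u u
    step : P u → H u w → Reach H P w v → Reach H P u v

  reach-map : (∀ {z} → P z → P′ z) → H ⊑ K → Reach H P u v → Reach K P′ u v
  reach-map f i nil = nil
  reach-map f i (step p h ρ) = step (f p) (i _ _ h) (reach-map f i ρ)

  reach-++ : Reach H P u v → Reach H P v w → Reach H P u w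
  reach-++ nil σ = σ
  reach-++ (step p h ρ) σ = step p h (reach-++ ρ σ)

  reach-tail : Reach H P u v → u ≢ v → Vtx H u
  reach-tail nil ne = ⊥-elim (ne refl)
  reach-tail (step _ h _) _ = tail-of h

  reach-head : H u w → Reach H P w v → Vtx H v
  reach-head h nil = head-of h
  reach-head _ (step _ h ρ) = reach-head h ρ

  reach-end : Reach H P u v → u ≢ v → Vtx H v
  reach-end nil ne = ⊥-elim (ne refl)
  reach-end (step _ h ρ) _ = reach-head h ρ

  reach-vtx : Reach H P u v → Vtx H v → Vtx H u
  reach-vtx nil i = i
  reach-vtx (step _ h _) _ = tail-of h

  -- Read from its end, the walk could pass from `H₂` into `H₁` only at `s`, which no edge of `H₂`
  -- enters, or at `t`, which has no outgoing edge and is not the end `r`.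
  confine-par : H ≐ H₁ ∪ H₂ → MeetAt₂ H₁ H₂ s t →
                (∀ {x} → ¬ H₂ x s) → (∀ {x} → ¬ H t x) →
                Reach H P u r → Vtx H₁ r → r ≢ t → Reach H₁ P u r
  confine-par e mt nin nout nil i r≢t = nil
  confine-par e mt nin nout (step p h ρ) i r≢t
    with confine-par e mt nin nout ρ i r≢t | to (e _ _) h
  ... | ρ₁ | inj₁ h₁ = step p h₁ ρ₁
  ... | ρ₁ | inj₂ h₂ with mt _ (reach-vtx ρ₁ i) (head-of h₂)
  ...   | inj₁ refl = ⊥-elim (nin h₂)
  confine-par e mt nin nout (step p h nil) i r≢t | ρ₁ | inj₂ h₂ | inj₂ refl = ⊥-elim (r≢t refl)
  confine-par e mt nin nout (step p h (step _ h′ _)) i r≢t | ρ₁ | inj₂ h₂ | inj₂ refl = ⊥-elim (nout h′)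

  -- Only `m` joins the factors and no edge of `H₂` enters it, so a walk that ends in `H₁` cannot
  -- have used an edge of `H₂`.
  confine-serˡ : H ≐ H₁ ∪ H₂ → MeetAt H₁ H₂ m → (∀ {x} → ¬ H₂ x m) →
                 Reach H P u r → Vtx H₁ r → Reach H₁ P u r
  confine-serˡ e mt nin nil i = nil
  confine-serˡ e mt nin (step p h ρ) i with confine-serˡ e mt nin ρ i | to (e _ _) h
  ... | ρ₁ | inj₁ h₁ = step p h₁ ρ₁
  ... | ρ₁ | inj₂ h₂ with refl ← mt _ (reach-vtx ρ₁ i) (head-of h₂) = ⊥-elim (nin h₂)

  confine-serʳ : H ≐ H₁ ∪ H₂ → MeetAt H₁ H₂ m → (∀ {x} → ¬ H₁ m x) →
                 Reach H P u r → Vtx H₂ u → Reach H₂ P u r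
  confine-serʳ e mt nout nil i = nil
  confine-serʳ e mt nout (step p h ρ) i with to (e _ _) h
  ... | inj₁ h₁ with refl ← mt _ (tail-of h₁) i = ⊥-elim (nout h₁)
  ... | inj₂ h₂ = step p h₂ (confine-serʳ e mt nout ρ (head-of h₂))

  -- The portion in `H₁` is discarded on arrival at `m`. The rest still satisfies `P`, so
  -- `bypass-closed` can hand a walk that misses `x` on to the second factor.
  cross-ser : H ≐ H₁ ∪ H₂ → MeetAt H₁ H₂ m → (∀ {x} → ¬ H₁ m x) →
              Reach H P u r → Vtx H₁ u → Vtx H₂ r → Reach H₂ P m r
  cross-ser e mt nout nil i j with refl ← mt _ i j = nil
  cross-ser e mt nout (step p h ρ) i j with to (e _ _) h
  ... | inj₁ h₁ = cross-ser e mt nout ρ (head-of h₁) j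
  ... | inj₂ h₂ with refl ← mt _ i (tail-of h₂) =
    step p h₂ (confine-serʳ e mt nout ρ (head-of h₂))

  from-source : DSP H s t → Vtx H x → Reach H U s x
  to-sink : DSP H s t → Vtx H x → Reach H U x t

  from-source (single _ e) (_ , inj₁ h) with refl ← proj₁ (to (e _ _) h) = nil
  from-source (single _ e) (_ , inj₂ h) with refl ← proj₁ (to (e _ _) h) = step _ h nil
  from-source (par _ _ D₁ D₂ e _ _) i with vtx-split e i
  ... | inj₁ i₁ = reach-map id (∪-left e) (from-source D₁ i₁)
  ... | inj₂ i₂ = reach-map id (∪-right e) (from-source D₂ i₂)
  from-source (ser _ _ _ D₁ D₂ e _) i with vtx-split e i
  ... | inj₁ i₁ = reach-map id (∪-left e) (from-source D₁ i₁)
  ... | inj₂ i₂ = reach-++ (reach-map id (∪-left e) (to-sink D₁ (source-vtx D₁)))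
                           (reach-map id (∪-right e) (from-source D₂ i₂))

  to-sink (single _ e) (_ , inj₁ h) with refl ← proj₂ (to (e _ _) h) = step _ h nil
  to-sink (single _ e) (_ , inj₂ h) with refl ← proj₂ (to (e _ _) h) = nil
  to-sink (par _ _ D₁ D₂ e _ _) i with vtx-split e i
  ... | inj₁ i₁ = reach-map id (∪-left e) (to-sink D₁ i₁)
  ... | inj₂ i₂ = reach-map id (∪-right e) (to-sink D₂ i₂)
  to-sink (ser _ _ _ D₁ D₂ e _) i with vtx-split e i
  ... | inj₁ i₁ = reach-++ (reach-map id (∪-left e) (to-sink D₁ i₁))
                           (reach-map id (∪-right e) (to-sink D₂ (source-vtx D₂)))
  ... | inj₂ i₂ = reach-map id (∪-right e) (to-sink D₂ i₂)

  -- Bypassed vertices.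

  -- The one-step form of a trap: once a walk from `s` to `r` goes around `x`, no edge out of `x`
  -- escapes from the vertices that lead to `r`.
  BypassClosed : ERel n → Fin n → Set
  BypassClosed H s = ∀ {r x y} → Reach H (_≢ x) s r → x ≢ r → Reach H U x r →
                     H x y → Reach H U y r

  private
    -- Both walks are confined to `H₁`. An edge of `H₂` out of `x` would make `x` equal to `t`,
    -- which has no outgoing edge, or to `s`, where the walk that misses `x` begins.
    bypass-par : DSP H₁ s t → DSP H₂ s t → H ≐ H₁ ∪ H₂ → MeetAt₂ H₁ H₂ s t →
                 (∀ {x} → ¬ H t x) → BypassClosed H₁ s →
                 Reach H (_≢ x) s r → x ≢ r → Reach H U x r → H x y →
                 Vtx H₁ r → r ≢ t → Reach H U y r
    bypass-par D₁ D₂ e mt nout IH ρ x≢r σ h i r≢t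
      with to (e _ _) h
         | confine-par e mt (no-in-source D₂) nout ρ i r≢t
         | confine-par e mt (no-in-source D₂) nout σ i r≢t
    ... | inj₁ h₁ | ρ₁ | σ₁ = reach-map id (∪-left e) (IH ρ₁ x≢r σ₁ h₁)
    ... | inj₂ h₂ | ρ₁ | σ₁ with mt _ (reach-tail σ₁ x≢r) (tail-of h₂)
    ...   | inj₂ refl = ⊥-elim (nout h)
    bypass-par D₁ D₂ e mt nout IH nil x≢r σ h i r≢t | inj₂ h₂ | ρ₁ | σ₁ | inj₁ refl = ⊥-elim (x≢r refl)
    bypass-par D₁ D₂ e mt nout IH (step p _ _) x≢r σ h i r≢t | inj₂ h₂ | ρ₁ | σ₁ | inj₁ refl = ⊥-elim (p refl)

  -- Fails without series-parallelity: in W take s = a, r = c, x = b and y = d.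
  bypass-closed : DSP H s t → BypassClosed H s
  bypass-closed (single _ e) nil x≢r σ h with refl ← proj₁ (to (e _ _) h) = ⊥-elim (x≢r refl)
  bypass-closed (single _ e) (step p _ _) x≢r σ h with refl ← proj₁ (to (e _ _) h) = ⊥-elim (p refl)
  bypass-closed {t = t} D@(par _ _ D₁ D₂ e _ mt) {r = r} ρ x≢r σ h
    with r ≟ t
  ... | yes refl = to-sink D (head-of h)
  ... | no r≢t with vtx-split e (reach-end σ x≢r)
  ...   | inj₁ i₁ = bypass-par D₁ D₂ e mt (no-out-sink D) (bypass-closed D₁) ρ x≢r σ h i₁ r≢t
  ...   | inj₂ i₂ = bypass-par D₂ D₁ (∪-swap e) (λ x i j → mt x j i) (no-out-sink D)
                      (bypass-closed D₂) ρ x≢r σ h i₂ r≢t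
  bypass-closed D@(ser m _ _ D₁ D₂ e mt) ρ x≢r σ h with vtx-split e (reach-end σ x≢r)
  ... | inj₁ i₁ with confine-serˡ e mt (no-in-source D₂) σ i₁ | to (e _ _) h
  ...   | σ₁ | inj₁ h₁ = reach-map id (∪-left e)
    (bypass-closed D₁ (confine-serˡ e mt (no-in-source D₂) ρ i₁) x≢r σ₁ h₁)
  -- Here `x` is `m`, the sink of `H₁`, so the walk from `x` to `r` inside `H₁` cannot take a first
  -- step.
  ...   | σ₁ | inj₂ h₂ with refl ← mt _ (reach-tail σ₁ x≢r) (tail-of h₂) =
    ⊥-elim (reach-stuck σ₁)
    where
    reach-stuck : Reach _ U m _ → ⊥
    reach-stuck nil = x≢r refl
    reach-stuck (step _ h _) = no-out-sink D₁ h
  bypass-closed D@(ser m _ _ D₁ D₂ e mt) ρ x≢r σ h | inj₂ i₂ with to (e _ _) h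
  -- With `y` in `H₁` and `r` in `H₂` a walk through `m` always exists.
  ... | inj₁ h₁ = reach-++ (reach-map id (∪-left e) (to-sink D₁ (head-of h₁)))
                           (reach-map id (∪-right e) (from-source D₂ i₂))
  ... | inj₂ h₂ = reach-map id (∪-right e)
    (bypass-closed D₂ (cross-ser e mt (no-out-sink D₁) ρ (source-vtx D₁) i₂) x≢r
                   (confine-serʳ e mt (no-out-sink D₁) σ (tail-of h₂)) h₂)

  -- Simple paths as vertex lists.

  Meet : List (Fin n) → List (Fin n) → Fin n → Set
  Meet xs ys z = ∀ {x} → x ∈ xs → x ∈ ys → x ≡ z

  Apart : List (Fin n) → List (Fin n) → Set
  Apart xs ys = ∀ {x} → x ∈ xs → x ∈ ys → ⊥

  -- Concatenation of paths: the head of ys is the last vertex of xs.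
  _⋈_ : List (Fin n) → List (Fin n) → List (Fin n)
  xs ⋈ ys = xs ++ drop 1 ys

  drop-⊆ : x ∈ drop 1 xs → x ∈ xs
  drop-⊆ {xs = _ ∷ _} = there

  ∈-⋈⁻ : ∀ xs ys → x ∈ xs ⋈ ys → x ∈ xs ⊎ x ∈ ys
  ∈-⋈⁻ xs ys = Sum.map₂ (drop-⊆ {xs = ys}) ∘ ∈-++⁻ xs

  source∈ : Walk E xs u v → u ∈ xs
  source∈ (one _) = here refl
  source∈ (cons _ _) = here refl

  sink∈ : Walk E xs u v → v ∈ xs
  sink∈ (one _) = here refl
  sink∈ (cons _ ω) = there (sink∈ ω)

  walk-⋈ : Walk E xs u m → Walk E ys m v → Walk E (xs ⋈ ys) u v
  walk-⋈ (one _) (one _) = one _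
  walk-⋈ (one _) (cons e ω) = cons e ω
  walk-⋈ (cons e ω) ω′ = cons e (walk-⋈ ω ω′)

  path-⋈ : Path E xs u m → Path E ys m v → Meet xs ys m → Path E (xs ⋈ ys) u v
  path-⋈ {ys = ys} (ω , ux) (ω′ , uy) meet =
    walk-⋈ ω ω′ , ++⁺ ux (drop⁺ 1 uy)
      -- A repeated vertex would be `m`, which heads `ys` and does not recur in the rest.
      λ (i , j) → m∉ ω′ uy (subst (_∈ _) (meet i (drop-⊆ {xs = ys} j)) j)
    where
    m∉ : ∀ {ys} → Walk E ys m v → Unique ys → m ∉ drop 1 ys
    m∉ (one _) _ ()
    m∉ (cons _ _) uy = Unique[x∷xs]⇒x∉xs uy

  consec-⋈ˡ : Consec x y xs → Consec x y (xs ⋈ ys)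
  consec-⋈ˡ here = here
  consec-⋈ˡ {ys = ys} (there h) = there (consec-⋈ˡ {ys = ys} h)

  consec-⋈ʳ : Walk E xs u m → Walk E ys m v → Consec x y ys → Consec x y (xs ⋈ ys)
  consec-⋈ʳ (one _) (one _) h = h
  consec-⋈ʳ (one _) (cons _ _) h = h
  consec-⋈ʳ (cons _ ω) ω′ h = there (consec-⋈ʳ ω ω′ h)

  edge-path : u ≢ v → E u v ≡ true → Path E (u ∷ v ∷ []) u v
  edge-path ne e = cons e (one _) , (ne ∷ []) ∷ [] ∷ []

  consec∈ˡ : Consec x y xs → x ∈ xs
  consec∈ˡ here = here refl
  consec∈ˡ (there h) = there (consec∈ˡ h)

  consec∈ʳ : Consec x y xs → y ∈ xs
  consec∈ʳ here = there (here refl)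
  consec∈ʳ (there h) = there (consec∈ʳ h)

  consec-edge : Walk E xs u v → Consec x y xs → E x y ≡ true
  consec-edge (cons e _) here = e
  consec-edge (cons _ ω) (there h) = consec-edge ω h

  -- Simple paths inside a series-parallel graph.

  record PathIn (E : Fin n → Fin n → Bool) (V : Fin n → Set) (u v : Fin n) : Set where
    constructor mkPath
    field
      {verts} : List (Fin n)
      path : Path E verts u v
      inside : ∀ {x} → x ∈ verts → V x
    walk : Walk E verts u v
    walk = proj₁ path
  open PathIn using (verts; path; inside; walk)

  widen : (∀ {z} → P z → P′ z) → PathIn E P u v → PathIn E P′ u v
  widen f p = mkPath (path p) (f ∘ inside p)

  _⨾_[_] : (p : PathIn E P u m) (q : PathIn E P m v) → Meet (verts p) (verts q) m → PathIn E P u v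
  p ⨾ q [ meet ] = mkPath (path-⋈ (path p) (path q) meet)
    ([ inside p , inside q ]′ ∘ ∈-⋈⁻ (verts p) (verts q))

  record Through (E : Fin n → Fin n → Bool) (V : Fin n → Set) (s x t : Fin n) : Set where
    constructor mkThrough
    field
      before : PathIn E V s x
      after : PathIn E V x t
      meet : Meet (verts before) (verts after) x
  open Through using (before; after; meet)

  sink∉before : (τ : Through E P s x t) → x ≢ t → t ∉ verts (before τ)
  sink∉before τ x≢t p = x≢t (sym (meet τ p (sink∈ (walk (after τ)))))

  source∉after : (τ : Through E P s x t) → x ≢ s → s ∉ verts (after τ)
  source∉after τ x≢s p = x≢s (sym (meet τ (source∈ (walk (before τ))) p))

  trivial : P u → PathIn E P u u
  trivial p = mkPath (one _ , [] ∷ []) λ { (here refl) → p }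

  -- In a P-composition the path stays in the part of `x`; in an S-composition it is continued by a
  -- spanning path of the other part, which can touch it only at `m`. Splitting at the sink leaves
  -- the whole spanning path in the first half, which is how `span` is obtained.
  through : DSP H s t → H ⊑ edges E → Vtx H x → Through E (Vtx H) s x t
  span : DSP H s t → H ⊑ edges E → PathIn E (Vtx H) s t

  through {H = H} {E = E} (single {s = s} {t = t} ne e) ι i = go i
    where
    h = from (e _ _) (refl , refl)
    st : PathIn E (Vtx H) s t
    st = mkPath (edge-path ne (ι _ _ h)) λ
      { (here refl) → tail-of h ; (there (here refl)) → head-of h }
    go : ∀ {x} → Vtx H x → Through E (Vtx H) s x t
    go (tail-of h′) with refl ← proj₁ (to (e _ _) h′) =
      mkThrough (trivial (tail-of h)) st λ { (here p) _ → p }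
    go (head-of h′) with refl ← proj₂ (to (e _ _) h′) =
      mkThrough st (trivial (head-of h)) λ { _ (here p) → p }
  through (par _ _ D₁ D₂ e _ _) ι i with vtx-split e i
  ... | inj₁ i₁ = mkThrough (widen (vtxˡ e) (before τ)) (widen (vtxˡ e) (after τ)) (meet τ)
    where τ = through D₁ (⊑-trans (∪-left e) ι) i₁
  ... | inj₂ i₂ = mkThrough (widen (vtxʳ e) (before τ)) (widen (vtxʳ e) (after τ)) (meet τ)
    where τ = through D₂ (⊑-trans (∪-right e) ι) i₂
  through (ser m _ _ D₁ D₂ e mt) ι i with vtx-split e i
  ... | inj₁ i₁ = mkThrough (widen (vtxˡ e) (before τ))
      (widen (vtxˡ e) (after τ) ⨾ widen (vtxʳ e) σ [ (λ i j → mt _ (inside (after τ) i) (inside σ j)) ])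
      λ i j → [ meet τ i , before∩σ i ]′ (∈-⋈⁻ (verts (after τ)) (verts σ) j)
    where
    τ = through D₁ (⊑-trans (∪-left e) ι) i₁
    σ = span D₂ (⊑-trans (∪-right e) ι)
    -- A common vertex is `m`, which also ends the second half of `τ`; the two halves share only
    -- `x`.
    before∩σ : Meet (verts (before τ)) (verts σ) _
    before∩σ i j with refl ← mt _ (inside (before τ) i) (inside σ j) =
      meet τ i (sink∈ (walk (after τ)))
  ... | inj₂ i₂ = mkThrough
      (widen (vtxˡ e) σ ⨾ widen (vtxʳ e) (before τ) [ (λ i j → mt _ (inside σ i) (inside (before τ) j)) ])
      (widen (vtxʳ e) (after τ))
      λ i j → [ (λ k → σ∩after k j) , (λ k → meet τ k j) ]′ (∈-⋈⁻ (verts σ) (verts (before τ)) i)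
    where
    τ = through D₂ (⊑-trans (∪-right e) ι) i₂
    σ = span D₁ (⊑-trans (∪-left e) ι)
    σ∩after : Meet (verts σ) (verts (after τ)) _
    σ∩after i j with refl ← mt _ (inside σ i) (inside (after τ) j) =
      meet τ (source∈ (walk (before τ))) j

  span D ι = before (through D ι (sink-vtx D))

  -- The edges of a series-parallel graph are edges of its source-sink paths.
  path-through : DSP H s t → H ⊑ edges E → H x y →
                 Σ (PathIn E (Vtx H) s t) λ p → Consec x y (verts p)
  path-through D@(single ne e) ι h with refl , refl ← to (e _ _) h =
    mkPath (edge-path ne (ι _ _ h)) (λ
      { (here refl) → tail-of h ; (there (here refl)) → head-of h }) , here
  path-through (par _ _ D₁ D₂ e _ _) ι h with to (e _ _) h
  ... | inj₁ h₁ with p , k ← path-through D₁ (⊑-trans (∪-left e) ι) h₁ = widen (vtxˡ e) p , k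
  ... | inj₂ h₂ with p , k ← path-through D₂ (⊑-trans (∪-right e) ι) h₂ = widen (vtxʳ e) p , k
  path-through (ser _ _ _ D₁ D₂ e mt) ι h with to (e _ _) h
  ... | inj₁ h₁ with p , k ← path-through D₁ (⊑-trans (∪-left e) ι) h₁
                   | q ← span D₂ (⊑-trans (∪-right e) ι) =
    widen (vtxˡ e) p ⨾ widen (vtxʳ e) q [ (λ i j → mt _ (inside p i) (inside q j)) ] ,
    consec-⋈ˡ {ys = verts q} k
  ... | inj₂ h₂ with p ← span D₁ (⊑-trans (∪-left e) ι)
                   | q , k ← path-through D₂ (⊑-trans (∪-right e) ι) h₂ =
    widen (vtxˡ e) p ⨾ widen (vtxʳ e) q [ (λ i j → mt _ (inside p i) (inside q j)) ] ,
    consec-⋈ʳ (walk p) (walk q) k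

  -- Assembling a subdivision of W.

  private
    choose : (p₁ p₂ p₃ p₄ p₅ : List (Fin n)) → WE → List (Fin n)
    choose p₁ p₂ p₃ p₄ p₅ ab = p₁
    choose p₁ p₂ p₃ p₄ p₅ ac = p₂
    choose p₁ p₂ p₃ p₄ p₅ bd = p₃
    choose p₁ p₂ p₃ p₄ p₅ cd = p₄
    choose p₁ p₂ p₃ p₄ p₅ bc = p₅

    corner : (u v w x : Fin n) → WV → Fin n
    corner u v w x a = u
    corner u v w x b = v
    corner u v w x c = w
    corner u v w x d = x

  -- The paths are the legs `ab`, `ac`, `bd`, `cd`, `bc` in this order. The two pairs of legs
  -- without a common corner, `ab` with `cd` and `ac` with `bd`, force all four corners to be
  -- distinct.
  buildW : ∀ {p₁ p₂ p₃ p₄ p₅} →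
           Path E p₁ u v → Path E p₂ u w → Path E p₃ v x → Path E p₄ w x → Path E p₅ v w →
           Meet p₁ p₂ u → Meet p₁ p₃ v → Apart p₁ p₄ → Meet p₁ p₅ v →
           Apart p₂ p₃ → Meet p₂ p₄ w → Meet p₂ p₅ w →
           Meet p₃ p₄ x → Meet p₃ p₅ v → Meet p₄ p₅ w → WSubdivision E
  buildW {E = E} {u = u} {v = v} {w = w} {x = x} {p₁} {p₂} {p₃} {p₄} {p₅}
         P₁ P₂ P₃ P₄ P₅ m₁₂ m₁₃ m₁₄ m₁₅ m₂₃ m₂₄ m₂₅ m₃₄ m₃₅ m₄₅ = record
    { branch = corner u v w x
    ; injective = injective
    ; path = choose p₁ p₂ p₃ p₄ p₅
    ; isPath = λ { ab → P₁ ; ac → P₂ ; bd → P₃ ; cd → P₄ ; bc → P₅ }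
    ; disjoint = disjoint
    }
    where
    u≢v : u ≢ v
    u≢v refl = m₂₃ (source∈ (proj₁ P₂)) (source∈ (proj₁ P₃))
    u≢w : u ≢ w
    u≢w refl = m₁₄ (source∈ (proj₁ P₁)) (source∈ (proj₁ P₄))
    u≢x : u ≢ x
    u≢x refl = m₁₄ (source∈ (proj₁ P₁)) (sink∈ (proj₁ P₄))
    v≢w : v ≢ w
    v≢w refl = m₁₄ (sink∈ (proj₁ P₁)) (source∈ (proj₁ P₄))
    v≢x : v ≢ x
    v≢x refl = m₁₄ (sink∈ (proj₁ P₁)) (sink∈ (proj₁ P₄))
    w≢x : w ≢ x
    w≢x refl = m₂₃ (sink∈ (proj₁ P₂)) (sink∈ (proj₁ P₃))
    injective : ∀ p q → corner u v w x p ≡ corner u v w x q → p ≡ q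
    injective a a _ = refl
    injective a b e = ⊥-elim (u≢v e)
    injective a c e = ⊥-elim (u≢w e)
    injective a d e = ⊥-elim (u≢x e)
    injective b a e = ⊥-elim (u≢v (sym e))
    injective b b _ = refl
    injective b c e = ⊥-elim (v≢w e)
    injective b d e = ⊥-elim (v≢x e)
    injective c a e = ⊥-elim (u≢w (sym e))
    injective c b e = ⊥-elim (v≢w (sym e))
    injective c c _ = refl
    injective c d e = ⊥-elim (w≢x e)
    injective d a e = ⊥-elim (u≢x (sym e))
    injective d b e = ⊥-elim (v≢x (sym e))
    injective d c e = ⊥-elim (w≢x (sym e))
    injective d d _ = refl
    disjoint : ∀ e e′ → e ≢ e′ → ∀ z →
               Internal z (choose p₁ p₂ p₃ p₄ p₅ e) (corner u v w x (tail e)) (corner u v w x (head e)) →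
               z ∉ choose p₁ p₂ p₃ p₄ p₅ e′
    disjoint ab ab ne _ _ _ = ne refl
    disjoint ab ac _ _ (i , ≢u , ≢v) j = ≢u (m₁₂ i j)
    disjoint ab bd _ _ (i , ≢u , ≢v) j = ≢v (m₁₃ i j)
    disjoint ab cd _ _ (i , ≢u , ≢v) j = m₁₄ i j
    disjoint ab bc _ _ (i , ≢u , ≢v) j = ≢v (m₁₅ i j)
    disjoint ac ab _ _ (i , ≢u , ≢w) j = ≢u (m₁₂ j i)
    disjoint ac ac ne _ _ _ = ne refl
    disjoint ac bd _ _ (i , ≢u , ≢w) j = m₂₃ i j
    disjoint ac cd _ _ (i , ≢u , ≢w) j = ≢w (m₂₄ i j)
    disjoint ac bc _ _ (i , ≢u , ≢w) j = ≢w (m₂₅ i j)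
    disjoint bd ab _ _ (i , ≢v , ≢x) j = ≢v (m₁₃ j i)
    disjoint bd ac _ _ (i , ≢v , ≢x) j = m₂₃ j i
    disjoint bd bd ne _ _ _ = ne refl
    disjoint bd cd _ _ (i , ≢v , ≢x) j = ≢x (m₃₄ i j)
    disjoint bd bc _ _ (i , ≢v , ≢x) j = ≢v (m₃₅ i j)
    disjoint cd ab _ _ (i , ≢w , ≢x) j = m₁₄ j i
    disjoint cd ac _ _ (i , ≢w , ≢x) j = ≢w (m₂₄ j i)
    disjoint cd bd _ _ (i , ≢w , ≢x) j = ≢x (m₃₄ j i)
    disjoint cd cd ne _ _ _ = ne refl
    disjoint cd bc _ _ (i , ≢w , ≢x) j = ≢w (m₄₅ i j)
    disjoint bc ab _ _ (i , ≢v , ≢w) j = ≢v (m₁₅ j i)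
    disjoint bc ac _ _ (i , ≢v , ≢w) j = ≢w (m₂₅ j i)
    disjoint bc bd _ _ (i , ≢v , ≢w) j = ≢v (m₃₅ j i)
    disjoint bc cd _ _ (i , ≢v , ≢w) j = ≢w (m₄₅ j i)
    disjoint bc bc ne _ _ _ = ne refl

  -- Cut vertices, and paths attached outside the graph.

  assocˡ : H ≐ H₁ ∪ H₂ → H₁ ≐ K ∪ Q → H ≐ K ∪ (Q ∪ H₂)
  assocˡ e f x y = mk⇔
    ([ [ inj₁ , inj₂ ∘ inj₁ ]′ ∘ to (f x y) , inj₂ ∘ inj₂ ]′ ∘ to (e x y))
    (from (e x y) ∘ [ inj₁ ∘ ∪-left f x y , [ inj₁ ∘ ∪-right f x y , inj₂ ]′ ]′)

  assocʳ : H ≐ H₁ ∪ H₂ → H₂ ≐ K ∪ Q → H ≐ H₁ ∪ K ∪ Q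
  assocʳ e f x y = mk⇔
    ([ inj₁ ∘ inj₁ , [ inj₁ ∘ inj₂ , inj₂ ]′ ∘ to (f x y) ]′ ∘ to (e x y))
    (from (e x y) ∘ [ [ inj₁ , inj₂ ∘ ∪-left f x y ]′ , inj₂ ∘ ∪-right f x y ]′)

  absorbˡ : H ≐ H₁ ∪ H₂ → H ∪ Q ≐ H₁ ∪ Q ∪ H₂
  absorbˡ e x y = mk⇔
    [ [ inj₁ ∘ inj₁ , inj₂ ]′ ∘ to (e x y) , inj₁ ∘ inj₂ ]′
    [ [ inj₁ ∘ ∪-left e x y , inj₂ ]′ , inj₁ ∘ ∪-right e x y ]′

  absorbʳ : H ≐ H₁ ∪ H₂ → H ∪ Q ≐ H₁ ∪ (H₂ ∪ Q)
  absorbʳ e x y = mk⇔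
    [ [ inj₁ , inj₂ ∘ inj₁ ]′ ∘ to (e x y) , inj₂ ∘ inj₂ ]′
    [ inj₁ ∘ ∪-left e x y , [ inj₁ ∘ ∪-right e x y , inj₂ ]′ ]′

  meetAt-∪ʳ : MeetAt H K m → MeetAt H Q m → MeetAt H (K ∪ Q) m
  meetAt-∪ʳ {K = K} {Q = Q} p q x i j = [ p x i , q x i ]′ (vtx-∪ {H = K} {K = Q} j)

  meetAt-∪ˡ : MeetAt H Q m → MeetAt K Q m → MeetAt (H ∪ K) Q m
  meetAt-∪ˡ {H = H} {K = K} p q x i j =
    [ (λ k → p x k j) , (λ k → q x k j) ]′ (vtx-∪ {H = H} {K = K} i)

  record Cut (H : ERel n) (s x t : Fin n) : Set₁ where
    constructor mkCut
    field
      {L R} : ERel n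
      left : DSP L s x
      right : DSP R x t
      split : H ≐ L ∪ R
      meetAt : MeetAt L R x

  -- S-composition is associative, so `H₂` can be moved to the right of the cut. `L` could meet `H₂`
  -- only in `m`, and `m` is the sink of `R`, so it would be the cut vertex.
  cut-left : H ≐ H₁ ∪ H₂ → MeetAt H₁ H₂ m → DSP H₂ m t → Cut H₁ s x m → Cut H s x t
  cut-left {m = m} e mt D₂ (mkCut {L} {R} Dl Dr f mt′) =
    mkCut Dl (serDSP Dr D₂ λ z i j → mt z (vtxʳ f i) j) (assocˡ e f)
      (meetAt-∪ʳ {H = L} {K = R} mt′ λ z i j → L∩H₂ z i (mt z (vtxˡ f i) j))
    where
    L∩H₂ : ∀ z → Vtx L z → z ≡ m → z ≡ _
    L∩H₂ _ i refl = mt′ _ i (sink-vtx Dr)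

  cut-right : H ≐ H₁ ∪ H₂ → MeetAt H₁ H₂ m → DSP H₁ s m → Cut H₂ m x t → Cut H s x t
  cut-right {H₁ = H₁} {m = m} e mt D₁ (mkCut {L} {R} Dl Dr f mt′) =
    mkCut (serDSP D₁ Dl λ z i j → mt z i (vtxˡ f j)) Dr (assocʳ e f)
      (meetAt-∪ˡ {H = H₁} {Q = R} {K = L} (λ z i j → H₁∩R z (mt z i (vtxʳ f j)) j) mt′)
    where
    H₁∩R : ∀ z → z ≡ m → Vtx R z → z ≡ _
    H₁∩R _ refl j = mt′ _ (source-vtx Dl) j

  -- A vertex x that is not a cut vertex lies inside a branch of a parallel
  -- composition in H. Disjoint paths that leave H, one from x and one from the
  -- sink, and meet again complete that composition to W; dually for Entry.
  Exit Entry : (Fin n → Fin n → Bool) → ERel n → Fin n → Fin n → Set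
  Exit E H x t = ∀ {z xs ys} → Path E xs t z → Path E ys x z →
    (∀ {y} → y ∈ xs → Vtx H y → y ≡ t) → (∀ {y} → y ∈ ys → Vtx H y → y ≡ x) →
    Meet xs ys z → WSubdivision E
  Entry E H s x = ∀ {z xs ys} → Path E xs z s → Path E ys z x →
    (∀ {y} → y ∈ xs → Vtx H y → y ≡ s) → (∀ {y} → y ∈ ys → Vtx H y → y ≡ x) →
    Meet xs ys z → WSubdivision E

  -- The corners `a`, `b`, `c`, `d` are `s`, `x`, `t`, `z`: the path of `H₁` through `x` gives `ab`
  -- and `bc`, a path of `H₂` gives `ac`, and the two outside paths close up at `z`.
  exit-par : DSP H₁ s t → DSP H₂ s t → H ≐ H₁ ∪ H₂ → MeetAt₂ H₁ H₂ s t → H ⊑ edges E →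
             Vtx H₁ x → x ≢ s → x ≢ t → Exit E H x t
  exit-par {H₁ = H₁} {s = s} {t = t} {H₂ = H₂} {x = x} D₁ D₂ e mt ι i x≢s x≢t Pxs Pys xs∩H ys∩H xs∩ys =
    buildW (path (before τ)) (path σ) Pys Pxs (path (after τ))
      (λ p q → [ id , (λ { refl → ⊥-elim (t∉before p) }) ]′ (mt _ (inside (before τ) p) (inside σ q)))
      (λ p q → ys∩H q (vtxˡ e (inside (before τ) p)))
      (λ p q → t∉before (subst (_∈ _) (xs∩H q (vtxˡ e (inside (before τ) p))) p))
      (meet τ)
      (λ p q → x∉H₂ (subst (Vtx H₂) (ys∩H q (vtxʳ e (inside σ p))) (inside σ p)))
      (λ p q → xs∩H q (vtxʳ e (inside σ p)))
      (λ p q → [ (λ { refl → ⊥-elim (s∉after q) }) , id ]′ (mt _ (inside (after τ) q) (inside σ p)))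
      (λ p q → xs∩ys q p)
      (λ p q → ys∩H p (vtxˡ e (inside (after τ) q)))
      (λ p q → xs∩H p (vtxˡ e (inside (after τ) q)))
    where
    τ = through D₁ (⊑-trans (∪-left e) ι) i
    σ = span D₂ (⊑-trans (∪-right e) ι)
    t∉before = sink∉before τ x≢t
    s∉after = source∉after τ x≢s
    x∉H₂ : ¬ Vtx H₂ x
    x∉H₂ j = [ x≢s , x≢t ]′ (mt _ i j)

  -- The corners `a`, `b`, `c`, `d` are `z`, `s`, `x`, `t`.
  entry-par : DSP H₁ s t → DSP H₂ s t → H ≐ H₁ ∪ H₂ → MeetAt₂ H₁ H₂ s t → H ⊑ edges E →
              Vtx H₁ x → x ≢ s → x ≢ t → Entry E H s x
  entry-par {H₁ = H₁} {s = s} {t = t} {H₂ = H₂} {x = x} D₁ D₂ e mt ι i x≢s x≢t Pxs Pys xs∩H ys∩H xs∩ys =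
    buildW Pxs Pys (path σ) (path (after τ)) (path (before τ))
      xs∩ys
      (λ p q → xs∩H p (vtxʳ e (inside σ q)))
      (λ p q → s∉after (subst (_∈ _) (xs∩H p (vtxˡ e (inside (after τ) q))) q))
      (λ p q → xs∩H p (vtxˡ e (inside (before τ) q)))
      (λ p q → x∉H₂ (subst (Vtx H₂) (ys∩H p (vtxʳ e (inside σ q))) (inside σ q)))
      (λ p q → ys∩H p (vtxˡ e (inside (after τ) q)))
      (λ p q → ys∩H p (vtxˡ e (inside (before τ) q)))
      (λ p q → [ (λ { refl → ⊥-elim (s∉after q) }) , id ]′ (mt _ (inside (after τ) q) (inside σ p)))
      (λ p q → [ id , (λ { refl → ⊥-elim (t∉before q) }) ]′ (mt _ (inside (before τ) q) (inside σ p)))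
      (λ p q → meet τ q p)
    where
    τ = through D₁ (⊑-trans (∪-left e) ι) i
    σ = span D₂ (⊑-trans (∪-right e) ι)
    t∉before = sink∉before τ x≢t
    s∉after = source∉after τ x≢s
    x∉H₂ : ¬ Vtx H₂ x
    x∉H₂ j = [ x≢s , x≢t ]′ (mt _ i j)

  -- The search descends through S-compositions to the factor of `x`. If that is the first factor,
  -- its outside path must start at `m`, so a path of `H₂` from `m` to `t` is put in front of the
  -- given one.
  exit : DSP H s t → H ⊑ edges E → Vtx H x → x ≢ s → x ≢ t → Cut H s x t ⊎ Exit E H x t
  exit (single _ e) ι (tail-of h) x≢s x≢t = ⊥-elim (x≢s (proj₁ (to (e _ _) h)))
  exit (single _ e) ι (head-of h) x≢s x≢t = ⊥-elim (x≢t (proj₂ (to (e _ _) h)))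
  exit (par H₁ H₂ D₁ D₂ e _ mt) ι i x≢s x≢t with vtx-split e i
  ... | inj₁ i₁ = inj₂ (exit-par D₁ D₂ e mt ι i₁ x≢s x≢t)
  ... | inj₂ i₂ = inj₂ (exit-par D₂ D₁ (∪-swap e) (meetAt₂-sym {H = H₁} {K = H₂} mt) ι i₂ x≢s x≢t)
  exit {x = x} (ser m _ _ D₁ D₂ e mt) ι i x≢s x≢t with x ≟ m | vtx-split e i
  ... | yes refl | _ = inj₁ (mkCut D₁ D₂ e mt)
  ... | no x≢m | inj₁ i₁ = Sum.map (cut-left e mt D₂) extend
      (exit D₁ (⊑-trans (∪-left e) ι) i₁ x≢s x≢m)
    where
    σ = span D₂ (⊑-trans (∪-right e) ι)
    extend : Exit _ _ x m → Exit _ _ x _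
    extend X {xs = xs} Pxs Pys xs∩H ys∩H xs∩ys = X
      (path-⋈ (path σ) Pxs λ p q → xs∩H q (vtxʳ e (inside σ p)))
      Pys
      (λ p j → [ (λ k → mt _ j (inside σ k))
               , (λ k → mt _ j (subst (Vtx _) (sym (xs∩H k (vtxˡ e j))) (sink-vtx D₂))) ]′
               (∈-⋈⁻ (verts σ) xs p))
      (λ p j → ys∩H p (vtxˡ e j))
      (λ p q → [ (λ k → ⊥-elim (x∉H₂ (subst (Vtx _) (ys∩H q (vtxʳ e (inside σ k))) (inside σ k))))
               , (λ k → xs∩ys k q) ]′ (∈-⋈⁻ (verts σ) xs p))
      where
      x∉H₂ : ¬ Vtx _ x
      x∉H₂ j = x≢m (mt _ i₁ j)
  ... | no x≢m | inj₂ i₂ = Sum.map (cut-right e mt D₁)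
      (λ X Pxs Pys xs∩H ys∩H → X Pxs Pys (λ p → xs∩H p ∘ vtxʳ e) (λ p → ys∩H p ∘ vtxʳ e))
      (exit D₂ (⊑-trans (∪-right e) ι) i₂ x≢m x≢t)

  entry : DSP H s t → H ⊑ edges E → Vtx H x → x ≢ s → x ≢ t → Cut H s x t ⊎ Entry E H s x
  entry (single _ e) ι (tail-of h) x≢s x≢t = ⊥-elim (x≢s (proj₁ (to (e _ _) h)))
  entry (single _ e) ι (head-of h) x≢s x≢t = ⊥-elim (x≢t (proj₂ (to (e _ _) h)))
  entry (par H₁ H₂ D₁ D₂ e _ mt) ι i x≢s x≢t with vtx-split e i
  ... | inj₁ i₁ = inj₂ (entry-par D₁ D₂ e mt ι i₁ x≢s x≢t)
  ... | inj₂ i₂ = inj₂ (entry-par D₂ D₁ (∪-swap e) (meetAt₂-sym {H = H₁} {K = H₂} mt) ι i₂ x≢s x≢t)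
  entry {x = x} (ser m _ _ D₁ D₂ e mt) ι i x≢s x≢t with x ≟ m | vtx-split e i
  ... | yes refl | _ = inj₁ (mkCut D₁ D₂ e mt)
  ... | no x≢m | inj₁ i₁ = Sum.map (cut-left e mt D₂)
      (λ X Pxs Pys xs∩H ys∩H → X Pxs Pys (λ p → xs∩H p ∘ vtxˡ e) (λ p → ys∩H p ∘ vtxˡ e))
      (entry D₁ (⊑-trans (∪-left e) ι) i₁ x≢s x≢m)
  ... | no x≢m | inj₂ i₂ = Sum.map (cut-right e mt D₁) extend
      (entry D₂ (⊑-trans (∪-right e) ι) i₂ x≢m x≢t)
    where
    σ = span D₁ (⊑-trans (∪-left e) ι)
    extend : Entry _ _ m x → Entry _ _ _ x
    extend X {xs = xs} Pxs Pys xs∩H ys∩H xs∩ys = X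
      (path-⋈ Pxs (path σ) λ p q → xs∩H p (vtxˡ e (inside σ q)))
      Pys
      (λ p j → [ (λ k → mt _ (subst (Vtx _) (sym (xs∩H k (vtxʳ e j))) (source-vtx D₁)) j)
               , (λ k → mt _ (inside σ k) j) ]′
               (∈-⋈⁻ xs (verts σ) p))
      (λ p j → ys∩H p (vtxʳ e j))
      (λ p q → [ (λ k → xs∩ys k q)
               , (λ k → ⊥-elim (x∉H₁ (subst (Vtx _) (ys∩H q (vtxˡ e (inside σ k))) (inside σ k)))) ]′
               (∈-⋈⁻ xs (verts σ) p))
      where
      x∉H₁ : ¬ Vtx _ x
      x∉H₁ j = x≢m (mt _ j i₂)

  -- Ears and how they are attached.

  -- The ear Q is kept as a series-parallel graph instead of a vertex list, so that
  -- it grows by S-compositions and is attached by a P-composition.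
  record Ear (E : Fin n → Fin n → Bool) (H Q : ERel n) (u v : Fin n) : Set₁ where
    constructor mkEar
    field
      dsp : DSP Q u v
      Q⊑E : Q ⊑ edges E
      disjoint : Disjoint H Q
      meet : MeetAt₂ H Q u v

  ear-⊑ : H₁ ⊑ H → Ear E H Q u v → Ear E H₁ Q u v
  ear-⊑ i (mkEar D ι dj mt) =
    mkEar D ι (λ x y h → dj x y (i x y h)) (λ x j → mt x (vtx-mono i j))

  private
    -- If `v` cuts `H₂` into `L` and `R`, the ear is parallel to `H₁` followed by `L`, and `R` comes
    -- after both. Otherwise `H₁` and the ear provide paths from `s` to `m` and to `v`, which is
    -- what `Entry` for `H₂` asks for.
    ear-from-source : DSP H₁ s m → DSP H₂ m t → H ≐ H₁ ∪ H₂ → MeetAt H₁ H₂ m → H ⊑ edges E →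
                      Ear E H Q s v → Vtx H₂ v → v ≢ m →
                      DSP (H ∪ Q) s t ⊎ WSubdivision E
    ear-from-source {H₁ = H₁} {s = s} {m = m} {H₂ = H₂} {t = t} {H = H} {E = E} {Q = Q} {v = v}
                    D₁ D₂ e mt ι (mkEar DQ ιQ dj mtQ) i v≢m with v ≟ t
    ... | yes refl = inj₁ (parDSP (ser _ _ _ D₁ D₂ e mt) DQ dj mtQ)
    ... | no v≢t = Sum.map add (λ X → X (path σ) (path ω)
        (λ p → mt _ (inside σ p))
        (λ p j → [ (λ { refl → ⊥-elim (s∉H₂ j) }) , id ]′ (mtQ _ (vtxʳ e j) (inside ω p)))
        (λ p q → [ id , (λ { refl → ⊥-elim (v≢m (mt _ (inside σ p) i)) }) ]′
          (mtQ _ (vtxˡ e (inside σ p)) (inside ω q))))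
      (entry D₂ (⊑-trans (∪-right e) ι) i v≢m v≢t)
      where
      σ = span D₁ (⊑-trans (∪-left e) ι)
      ω = span DQ ιQ
      s∉H₂ : ¬ Vtx H₂ s
      s∉H₂ j = source≢sink D₁ (mt _ (source-vtx D₁) j)
      add : Cut H₂ m v t → DSP (H ∪ Q) s t
      add (mkCut {L} {R} Dl Dr f mt′) = DSP-resp (absorbˡ g) (serDSP
        (parDSP (serDSP D₁ Dl λ x j k → mt x j (vtxˡ f k)) DQ
                (λ x y h → dj x y (∪-left g x y h)) (λ x j → mtQ x (vtxˡ g j)))
        Dr
        (meetAt-∪ˡ {H = H₁ ∪ L} {Q = R} {K = Q}
          (meetAt-∪ˡ {H = H₁} {Q = R} {K = L}
            (λ x j k → H₁∩R (mt x j (vtxʳ f k)) k)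
            mt′)
          λ x j k → [ (λ { refl → ⊥-elim (s∉H₂ (vtxʳ f k)) }) , id ]′ (mtQ x (vtxʳ g k) j)))
        where
        g = assocʳ e f
        H₁∩R : x ≡ m → Vtx R x → x ≡ v
        H₁∩R refl k = mt′ _ (source-vtx Dl) k

    -- If `u` cuts `H₁`, splitting off the part before `u` turns the ear into one from the source.
    -- Otherwise the ear and a path of `H₂` from `m` meet again at `v`, as `Exit` for `H₁` requires.
    ear-across : DSP H₁ s m → DSP H₂ m t → H ≐ H₁ ∪ H₂ → MeetAt H₁ H₂ m → H ⊑ edges E →
                 Ear E H Q u v → Vtx H₁ u → u ≢ m → Vtx H₂ v → v ≢ m →
                 DSP (H ∪ Q) s t ⊎ WSubdivision E
    ear-across {H₁ = H₁} {s = s} {m = m} {H₂ = H₂} {t = t} {H = H} {E = E} {Q = Q} {u = u} {v = v}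
               D₁ D₂ e mt ι ε@(mkEar DQ ιQ dj mtQ) i u≢m j v≢m with u ≟ s
    ... | yes refl = ear-from-source D₁ D₂ e mt ι ε j v≢m
    ... | no u≢s = [ add , (λ X → inj₂ (X (path σ) (path ω)
        (λ p k → mt _ k (inside σ p))
        (λ p k → [ id , (λ { refl → ⊥-elim (v∉H₁ k) }) ]′ (mtQ _ (vtxˡ e k) (inside ω p)))
        (λ p q → [ (λ { refl → ⊥-elim (u≢m (mt _ i (inside σ p))) }) , id ]′
          (mtQ _ (vtxʳ e (inside σ p)) (inside ω q))))) ]′
      (exit D₁ (⊑-trans (∪-left e) ι) i u≢s u≢m)
      where
      σ = before (through D₂ (⊑-trans (∪-right e) ι) j)
      ω = span DQ ιQ
      v∉H₁ : ¬ Vtx H₁ v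
      v∉H₁ k = v≢m (mt _ k j)
      add : Cut H₁ s u m → DSP (H ∪ Q) s t ⊎ WSubdivision E
      add (mkCut {L} {R} Dl Dr f mt′) = Sum.map₁
        (λ D → DSP-resp (absorbʳ g) (serDSP Dl D
          (meetAt-∪ʳ {H = L} {K = R ∪ H₂} {Q = Q}
            (meetAt-∪ʳ {H = L} {K = R} {Q = H₂} mt′
              (λ x p q → L∩H₂ p (mt x (vtxˡ f p) q)))
            λ x p q → [ id , (λ { refl → ⊥-elim (v∉H₁ (vtxˡ f p)) }) ]′ (mtQ x (vtxˡ g p) q))))
        (ear-from-source Dr D₂ (λ _ _ → mk⇔ id id) (λ x p → mt x (vtxʳ f p))
          (⊑-trans (∪-right g) ι) (ear-⊑ (∪-right g) ε) j v≢m)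
        where
        g = assocˡ e f
        L∩H₂ : Vtx L x → x ≡ m → x ≡ u
        L∩H₂ p refl = mt′ _ p (sink-vtx Dr)

    -- An ear linking inner vertices of two parallel parts is itself the leg `bc`; the corners are
    -- `s`, `u`, `v`, `t`.
    ear-between : DSP H₁ s t → DSP H₂ s t → H ≐ H₁ ∪ H₂ → MeetAt₂ H₁ H₂ s t → H ⊑ edges E →
                  Ear E H Q u v → Vtx H₁ u → u ≢ s → u ≢ t → Vtx H₂ v → v ≢ s → v ≢ t →
                  WSubdivision E
    ear-between {H₁ = H₁} {s = s} {t = t} {H₂ = H₂} {u = u} {v = v}
                D₁ D₂ e mt ι (mkEar DQ ιQ dj mtQ) i u≢s u≢t j v≢s v≢t =
      buildW (path (before τ₁)) (path (before τ₂)) (path (after τ₁)) (path (after τ₂)) (path ω)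
        (λ p q → [ id , (λ { refl → ⊥-elim (sink∉before τ₁ u≢t p) }) ]′
          (mt _ (inside (before τ₁) p) (inside (before τ₂) q)))
        (meet τ₁)
        (λ p q → [ (λ { refl → source∉after τ₂ v≢s q }) , (λ { refl → sink∉before τ₁ u≢t p }) ]′
          (mt _ (inside (before τ₁) p) (inside (after τ₂) q)))
        (λ p q → Q∩H₁ q (inside (before τ₁) p))
        (λ p q → [ (λ { refl → source∉after τ₁ u≢s q }) , (λ { refl → sink∉before τ₂ v≢t p }) ]′
          (mt _ (inside (after τ₁) q) (inside (before τ₂) p)))
        (meet τ₂)
        (λ p q → Q∩H₂ q (inside (before τ₂) p))
        (λ p q → [ (λ { refl → ⊥-elim (source∉after τ₁ u≢s p) }) , id ]′
          (mt _ (inside (after τ₁) p) (inside (after τ₂) q)))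
        (λ p q → Q∩H₁ q (inside (after τ₁) p))
        (λ p q → Q∩H₂ q (inside (after τ₂) p))
      where
      τ₁ = through D₁ (⊑-trans (∪-left e) ι) i
      τ₂ = through D₂ (⊑-trans (∪-right e) ι) j
      ω = span DQ ιQ
      Q∩H₁ : x ∈ verts ω → Vtx H₁ x → x ≡ u
      Q∩H₁ p k = [ id , (λ { refl → ⊥-elim ([ v≢s , v≢t ]′ (mt _ k j)) }) ]′ (mtQ _ (vtxˡ e k) (inside ω p))
      Q∩H₂ : x ∈ verts ω → Vtx H₂ x → x ≡ v
      Q∩H₂ p k = [ (λ { refl → ⊥-elim ([ u≢s , u≢t ]′ (mt _ i k)) }) , id ]′ (mtQ _ (vtxʳ e k) (inside ω p))

  -- The third alternative is a backward ear, which closes a directed cycle with a walk of `H`;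
  -- `stuck` deals with it.
  Outcome : (Fin n → Fin n → Bool) → ERel n → ERel n → (s t u v : Fin n) → Set₁
  Outcome E H Q s t u v = DSP (H ∪ Q) s t ⊎ WSubdivision E ⊎ Reach H U v u

  -- Induction on the composition. An ear with both ends in one part is attached inside that part.
  -- Between parallel parts it yields W; along an S-composition it is treated by `ear-across`, and
  -- against it by the walk from `v` through `m` to `u`.
  add-ear : DSP H s t → H ⊑ edges E → Ear E H Q u v → Vtx H u → Vtx H v → Outcome E H Q s t u v

  private
    -- The enlarged part still meets `H₂` only in `s` and `t`, because the ear touches `H₂` at most
    -- in its own ends and these lie in `H₁`.
    ear-inside : H ≐ H₁ ∪ H₂ → DSP H₁ s t → DSP H₂ s t → Disjoint H₁ H₂ → MeetAt₂ H₁ H₂ s t →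
                 Ear E H Q u v → Vtx H₁ u → Vtx H₁ v →
                 Outcome E H₁ Q s t u v → Outcome E H Q s t u v
    ear-inside {H₁ = H₁} {H₂ = H₂} {Q = Q} e D₁ D₂ dj mt (mkEar DQ ιQ djQ mtQ) i j = Sum.map
      (λ D → DSP-resp (absorbˡ e) (parDSP D D₂
        (λ { x y (inj₁ h) → dj x y h ; x y (inj₂ q) h → djQ x y (∪-right e x y h) q })
        λ x k l → [ (λ p → mt x p l)
                  , (λ p → [ (λ { refl → mt _ i l }) , (λ { refl → mt _ j l }) ]′ (mtQ x (vtxʳ e l) p)) ]′
                  (vtx-∪ {H = H₁} {K = Q} k)))
      (Sum.map₂ (reach-map id (∪-left e)))

    -- An end at `s` or `t` belongs to both parts, so the ear can be viewed inside one of them. The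
    -- recursive calls come in as `case₁` and `case₂`, which lets the lemma serve both orders of the
    -- parts.
    ear-par : H ≐ H₁ ∪ H₂ → DSP H₁ s t → DSP H₂ s t → Disjoint H₁ H₂ → MeetAt₂ H₁ H₂ s t → H ⊑ edges E →
              (Vtx H₁ u → Vtx H₁ v → Outcome E H Q s t u v) →
              (Vtx H₂ u → Vtx H₂ v → Outcome E H Q s t u v) →
              Ear E H Q u v → Vtx H₁ u → Vtx H₂ v → Outcome E H Q s t u v
    ear-par {s = s} {t = t} {u = u} {v = v} e D₁ D₂ dj mt ι case₁ case₂ ε i j
      with u ≟ s | u ≟ t | v ≟ s | v ≟ t
    ... | yes refl | _ | _ | _ = case₂ (source-vtx D₂) j
    ... | no _ | yes refl | _ | _ = case₂ (sink-vtx D₂) j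
    ... | no _ | no _ | yes refl | _ = case₁ i (source-vtx D₁)
    ... | no _ | no _ | no _ | yes refl = case₁ i (sink-vtx D₁)
    ... | no u≢s | no u≢t | no v≢s | no v≢t =
      inj₂ (inj₁ (ear-between D₁ D₂ e mt ι ε i u≢s u≢t j v≢s v≢t))

  add-ear {H = H} D@(single {s = s} {t = t} ne e) ι (mkEar DQ ιQ dj mtQ) i j with ends i | ends j
    where
    ends : Vtx H x → x ≡ s ⊎ x ≡ t
    ends = single-vtx ∘ vtx-mono (λ x y → to (e x y))
  ... | inj₁ refl | inj₁ refl = ⊥-elim (source≢sink DQ refl)
  ... | inj₁ refl | inj₂ refl = inj₁ (parDSP D DQ dj mtQ)
  ... | inj₂ refl | inj₁ refl = inj₂ (inj₂ (from-source D (sink-vtx D)))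
  ... | inj₂ refl | inj₂ refl = ⊥-elim (source≢sink DQ refl)
  add-ear (par H₁ H₂ D₁ D₂ e dj mt) ι ε i j = go (vtx-split e i) (vtx-split e j)
    where
    mt′ : MeetAt₂ H₂ H₁ _ _
    mt′ = meetAt₂-sym {H = H₁} {K = H₂} mt
    dj′ : Disjoint H₂ H₁
    dj′ x y h h′ = dj x y h′ h
    case₁ : Vtx H₁ _ → Vtx H₁ _ → Outcome _ _ _ _ _ _ _
    case₁ k l = ear-inside e D₁ D₂ dj mt ε k l
      (add-ear D₁ (⊑-trans (∪-left e) ι) (ear-⊑ (∪-left e) ε) k l)
    case₂ : Vtx H₂ _ → Vtx H₂ _ → Outcome _ _ _ _ _ _ _
    case₂ k l = ear-inside (∪-swap e) D₂ D₁ dj′ mt′ ε k l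
      (add-ear D₂ (⊑-trans (∪-right e) ι) (ear-⊑ (∪-right e) ε) k l)
    go : Vtx H₁ _ ⊎ Vtx H₂ _ → Vtx H₁ _ ⊎ Vtx H₂ _ → Outcome _ _ _ _ _ _ _
    go (inj₁ k) (inj₁ l) = case₁ k l
    go (inj₁ k) (inj₂ l) = ear-par e D₁ D₂ dj mt ι case₁ case₂ ε k l
    go (inj₂ k) (inj₁ l) = ear-par (∪-swap e) D₂ D₁ dj′ mt′ ι case₂ case₁ ε k l
    go (inj₂ k) (inj₂ l) = case₂ k l
  add-ear {u = u} {v = v} (ser m H₁ H₂ D₁ D₂ e mt) ι ε@(mkEar DQ ιQ dj mtQ) i j =
    go (vtx-split e i) (vtx-split e j)
    where
    case₁ : Vtx H₁ u → Vtx H₁ v → Outcome _ _ _ _ _ _ _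
    case₁ k l = Sum.map
      (λ D → DSP-resp (absorbˡ e) (serDSP D D₂ (meetAt-∪ˡ {H = H₁} {Q = H₂} {K = _} mt
        λ x p q → [ (λ { refl → mt x k q }) , (λ { refl → mt x l q }) ]′ (mtQ x (vtxʳ e q) p))))
      (Sum.map₂ (reach-map id (∪-left e)))
      (add-ear D₁ (⊑-trans (∪-left e) ι) (ear-⊑ (∪-left e) ε) k l)
    case₂ : Vtx H₂ u → Vtx H₂ v → Outcome _ _ _ _ _ _ _
    case₂ k l = Sum.map
      (λ D → DSP-resp (absorbʳ e) (serDSP D₁ D (meetAt-∪ʳ {H = H₁} {K = H₂} {Q = _} mt
        λ x p q → [ (λ { refl → mt x p k }) , (λ { refl → mt x p l }) ]′ (mtQ x (vtxˡ e p) q))))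
      (Sum.map₂ (reach-map id (∪-right e)))
      (add-ear D₂ (⊑-trans (∪-right e) ι) (ear-⊑ (∪-right e) ε) k l)
    go : Vtx H₁ u ⊎ Vtx H₂ u → Vtx H₁ v ⊎ Vtx H₂ v → Outcome _ _ _ _ _ _ _
    go (inj₁ k) (inj₁ l) = case₁ k l
    go (inj₁ k) (inj₂ l) with u ≟ m | v ≟ m
    ... | yes refl | _ = case₂ (source-vtx D₂) l
    ... | no _ | yes refl = case₁ k (sink-vtx D₁)
    ... | no u≢m | no v≢m = Sum.map₂ inj₁ (ear-across D₁ D₂ e mt ι ε k u≢m l v≢m)
    go (inj₂ k) (inj₁ l) = inj₂ (inj₂ (reach-++ (reach-map id (∪-left e) (to-sink D₁ l))
                                                (reach-map id (∪-right e) (from-source D₂ k))))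
    go (inj₂ k) (inj₂ l) = case₂ k l

  -- Growing ears along a path, and paths trapped by a backward ear.

  single-ear : u ≢ v → E u v ≡ true → ¬ H u v → Ear E H ⟨ u , v ⟩ u v
  single-ear ne e ¬h = mkEar (edgeDSP ne) (λ { _ _ (refl , refl) → e })
    (λ { _ _ h (refl , refl) → ¬h h }) (λ _ _ → single-vtx)

  -- The old end `v` becomes an inner vertex of the ear and therefore has to lie off `H`.
  lengthen-ear : Ear E H Q u v → ¬ Vtx H v → E v w ≡ true → v ≢ w → ¬ Vtx Q w →
                 Ear E H (Q ∪ ⟨ v , w ⟩) u w
  lengthen-ear {H = H} {Q = Q} {u = u} {v = v} {w = w} (mkEar D ι dj mt) v∉H e v≢w w∉Q = mkEar
    (serDSP D (edgeDSP v≢w) λ x i j →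
      [ id , (λ { refl → ⊥-elim (w∉Q i) }) ]′ (single-vtx j))
    (λ { x y (inj₁ q) → ι x y q ; _ _ (inj₂ (refl , refl)) → e })
    (λ { x y h (inj₁ q) → dj x y h q ; _ _ h (inj₂ (refl , refl)) → v∉H (tail-of h) })
    λ x i j → [ (λ k → [ inj₁ , (λ { refl → ⊥-elim (v∉H i) }) ]′ (mt x i k))
              , (λ k → [ (λ { refl → ⊥-elim (v∉H i) }) , inj₂ ]′ (single-vtx k)) ]′
              (vtx-∪ {H = Q} {K = ⟨ v , w ⟩} j)

  lengthen-reach : Reach Q P u v → P v → Reach (Q ∪ ⟨ v , w ⟩) P u w
  lengthen-reach ρ p = reach-++ (reach-map id (λ _ _ → inj₁) ρ) (step p (inj₂ (refl , refl)) nil)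

  reach-holds : Reach H P u v → u ≢ v → P u
  reach-holds nil ne = ⊥-elim (ne refl)
  reach-holds (step p _ _) _ = p

  fresh-∪ : Unique (v ∷ w ∷ xs) → (∀ {z} → z ∈ w ∷ xs → ¬ Vtx Q z) →
            ∀ {z} → z ∈ xs → ¬ Vtx (Q ∪ ⟨ v , w ⟩) z
  fresh-∪ {v = v} {w = w} {Q = Q} uq fresh i j with vtx-∪ {H = Q} {K = ⟨ v , w ⟩} j
  ... | inj₁ k = fresh (there i) k
  ... | inj₂ k with single-vtx k
  ...   | inj₁ refl = Unique[x∷xs]⇒x∉xs uq (there i)
  fresh-∪ (_ ∷ uq) fresh i j | inj₂ k | inj₂ refl = Unique[x∷xs]⇒x∉xs uq i

  fresh-single : Unique (v ∷ w ∷ xs) → ∀ {z} → z ∈ xs → ¬ Vtx ⟨ v , w ⟩ z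
  fresh-single uq i j with single-vtx j
  ... | inj₁ refl = Unique[x∷xs]⇒x∉xs uq (there i)
  fresh-single (_ ∷ uq) i j | inj₂ refl = Unique[x∷xs]⇒x∉xs uq i

  head≢ : Unique (v ∷ w ∷ xs) → v ≢ w
  head≢ ((ne ∷ _) ∷ _) = ne

  -- `P` separates the two walks: the one to `r` satisfies it and the one from `x` violates it.
  -- Hence each vertex left on the way to `y` is bypassed, and the one-step property iterates.
  bypass-closed* : DSP H s t → Reach H P s r → P r → Reach H (∁ P) x y → Reach H U x r → Reach H U y r
  bypass-closed* D ρ p nil σ = σ
  bypass-closed* D ρ p (step ¬p h τ) σ = bypass-closed* D ρ p τ
    (bypass-closed D (reach-map (λ { q refl → ¬p q }) (λ _ _ h → h) ρ) (λ { refl → ¬p p }) σ h)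

  ∪-⊑ : H ⊑ Q → K ⊑ Q → H ∪ K ⊑ Q
  ∪-⊑ i j x y = [ i x y , j x y ]′

  -- A path that has returned by a backward ear to a vertex x below r, where the part
  -- of H already traversed leads from s to r, stays below r by bypass-closed, so it
  -- never reaches t. The ears it uses meanwhile are added to H as long as they fit.
  stuck : DSP H s t → H ⊑ edges E → Reach H P s r → P r → Reach H U x r →
          Walk E (x ∷ xs) x t → Unique (x ∷ xs) → (∀ {z} → z ∈ x ∷ xs → ∁ P z) → WSubdivision E
  stuck-on-ear : DSP H s t → H ⊑ edges E → Reach H P s r → P r → Reach H U x r →
                 Ear E H Q x w → Reach Q (∁ P) x w → (∀ {z} → z ∈ xs → ¬ Vtx Q z) →
                 Walk E (w ∷ xs) w t → Unique (w ∷ xs) → (∀ {z} → z ∈ w ∷ xs → ∁ P z) → WSubdivision E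

  -- The path cannot end here: `t` has no outgoing edge, so it leads to `r` only if it is `r`, and
  -- `r` satisfies `P` while the path avoids `P`.
  stuck D ι ρ p nil (one _) uq avoid = ⊥-elim (avoid (here refl) p)
  stuck D ι ρ p (step _ h _) (one _) uq avoid = ⊥-elim (no-out-sink D h)
  stuck {x = x} D ι ρ p σ (cons {w = w} e ω) uq@(_ ∷ uq′) avoid with edge? D x w
  ... | yes h = stuck D ι ρ p (bypass-closed* D ρ p (step (avoid (here refl)) h nil) σ) ω uq′ (avoid ∘ there)
  ... | no ¬h = stuck-on-ear D ι ρ p σ (single-ear (head≢ uq) e ¬h)
    (step (avoid (here refl)) (refl , refl) nil) (fresh-single uq) ω uq′ (avoid ∘ there)

  stuck-on-ear {w = w} D ι ρ p σ ε τ fresh ω uq avoid with vtx? D w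
  stuck-on-ear {P = P} {x = x} D ι ρ p σ ε τ fresh ω uq avoid | yes j
    -- `x` differs from `r`, since it violates `P`, so the walk `σ` has an edge of `H` at `x`.
    with add-ear D ι ε (reach-tail σ λ { refl → reach-holds τ (source≢sink (Ear.dsp ε)) p }) j
  ... | inj₁ D′ = stuck D′ (∪-⊑ ι (Ear.Q⊑E ε)) ρ′ p
    (bypass-closed* D′ ρ′ p (reach-map id (λ _ _ → inj₂) τ) (reach-map id (λ _ _ → inj₁) σ)) ω uq avoid
    where ρ′ = reach-map id (λ _ _ → inj₁) ρ
  ... | inj₂ (inj₁ X) = X
  -- Another backward ear is dropped: its end already leads to `x` in `H`, and thus to `r`.
  ... | inj₂ (inj₂ back) = stuck D ι ρ p (reach-++ back σ) ω uq avoid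
  stuck-on-ear D ι ρ p σ ε τ fresh (one _) uq avoid | no w∉H = ⊥-elim (w∉H (sink-vtx D))
  stuck-on-ear D ι ρ p σ ε τ fresh (cons e ω) uq@(_ ∷ uq′) avoid | no w∉H =
    stuck-on-ear D ι ρ p σ (lengthen-ear ε w∉H e (head≢ uq) (fresh (here refl)))
      (lengthen-reach τ (avoid (here refl))) (fresh-∪ uq fresh) ω uq′ (avoid ∘ there)

  -- Absorbing one source-sink path.

  record Extension (E : Fin n → Fin n → Bool) (H : ERel n) (s t : Fin n) (F : ERel n) : Set₁ where
    constructor mkExt
    field
      {graph} : ERel n
      dsp : DSP graph s t
      graph⊑E : graph ⊑ edges E
      old⊑graph : H ⊑ graph
      new⊑graph : F ⊑ graph

  Consecutive : List (Fin n) → ERel n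
  Consecutive xs x y = Consec x y xs

  consec-cons : Q u v → Q ⊑ K → Consecutive (v ∷ xs) ⊑ K → Consecutive (u ∷ v ∷ xs) ⊑ K
  consec-cons q i f _ _ here = i _ _ q
  consec-cons q i f _ _ (there h) = f _ _ h

  -- The invariant is a walk of `H` from `s` to the current vertex that misses the rest of the path.
  -- It records the part already traversed, which `stuck` needs as the blocked part.
  follow : DSP H s t → H ⊑ edges E → Vtx H u → Reach H (_∉ u ∷ xs) s u →
           Walk E (u ∷ xs) u t → Unique (u ∷ xs) →
           WSubdivision E ⊎ Extension E H s t (Consecutive (u ∷ xs))
  follow-ear : DSP H s t → H ⊑ edges E → Vtx H u → Reach H (_∉ w ∷ xs) s u →
               Ear E H Q u w → Reach Q (_∉ w ∷ xs) u w → (∀ {z} → z ∈ xs → ¬ Vtx Q z) →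
               Walk E (w ∷ xs) w t → Unique (w ∷ xs) →
               WSubdivision E ⊎ Extension E (H ∪ Q) s t (Consecutive (w ∷ xs))

  follow D ι i ρ (one _) uq = inj₂ (mkExt D ι (λ _ _ h → h) λ { _ _ (there ()) })
  follow {H = H} {u = u} D ι i ρ (cons {w = w} e ω) uq@(_ ∷ uq′) with edge? D u w
  ... | yes h = Sum.map₂
    (λ { (mkExt D′ ι′ g f) → mkExt D′ ι′ g (consec-cons {Q = H} h g f) })
    (follow D ι (head-of h)
      (reach-++ (reach-map (_∘ there) (λ _ _ h → h) ρ) (step (Unique[x∷xs]⇒x∉xs uq) h nil)) ω uq′)
  ... | no ¬h = Sum.map₂
    (λ { (mkExt D′ ι′ g f) → mkExt D′ ι′ (λ x y → g x y ∘ inj₁)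
           (consec-cons {Q = H ∪ ⟨ u , w ⟩} (inj₂ (refl , refl)) g f) })
    (follow-ear D ι i (reach-map (_∘ there) (λ _ _ h → h) ρ) (single-ear (head≢ uq) e ¬h)
      (step (Unique[x∷xs]⇒x∉xs uq) (refl , refl) nil) (fresh-single uq) ω uq′)

  follow-ear {w = w} D ι i ρ ε τ fresh ω uq with vtx? D w
  follow-ear {H = H} {Q = Q} D ι i ρ ε τ fresh ω uq | yes j with add-ear D ι ε i j
  ... | inj₁ D′ = follow D′ (∪-⊑ ι (Ear.Q⊑E ε)) (vtx-mono {H = H} {K = H ∪ Q} (λ _ _ → inj₁) j)
    (reach-++ (reach-map id (λ _ _ → inj₁) ρ) (reach-map id (λ _ _ → inj₂) τ)) ω uq
  ... | inj₂ (inj₁ X) = inj₁ X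
  -- The trap is set with `r` the start `u` of the ear and with `P` the property of not lying on the
  -- remaining path.
  ... | inj₂ (inj₂ back) =
    inj₁ (stuck D ι ρ (reach-holds τ (source≢sink (Ear.dsp ε))) back ω uq λ k ∉ → ∉ k)
  follow-ear D ι i ρ ε τ fresh (one _) uq | no w∉H = ⊥-elim (w∉H (sink-vtx D))
  follow-ear {H = H} {w = v} {Q = Q} D ι i ρ ε τ fresh (cons {w = w} e ω) uq@(_ ∷ uq′)
    | no w∉H = Sum.map₂
    (λ { (mkExt D′ ι′ g f) → mkExt D′ ι′
           (λ { x y (inj₁ h) → g x y (inj₁ h) ; x y (inj₂ q) → g x y (inj₂ (inj₁ q)) })
           (consec-cons {Q = H ∪ (Q ∪ ⟨ v , w ⟩)} (inj₂ (inj₂ (refl , refl))) g f) })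
    (follow-ear D ι i (reach-map (_∘ there) (λ _ _ h → h) ρ)
      (lengthen-ear ε w∉H e (head≢ uq) (fresh (here refl)))
      (lengthen-reach (reach-map (_∘ there) (λ _ _ h → h) τ) (Unique[x∷xs]⇒x∉xs uq))
      (fresh-∪ uq fresh) ω uq′)

  -- The initial graph and the finite list of candidate paths.

  single-∈ : Vtx ⟨ u , v ⟩ x → x ∈ u ∷ v ∷ xs
  single-∈ i with single-vtx i
  ... | inj₁ eq = here eq
  ... | inj₂ eq = there (here eq)

  -- The bound on the vertices of `Q` is carried along so that the next edge, whose tail is not on
  -- the list, meets `Q` only at its head.
  path-DSP : Walk E (u ∷ xs) u v → Unique (u ∷ xs) → u ≢ v →
             Σ (ERel n) λ Q → DSP Q u v × Q ⊑ edges E × (∀ {z} → Vtx Q z → z ∈ u ∷ xs)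
  path-DSP (one _) uq u≢v = ⊥-elim (u≢v refl)
  path-DSP {u = u} (cons {w = w} e (one _)) uq u≢v =
    ⟨ u , w ⟩ , edgeDSP u≢v , (λ { _ _ (refl , refl) → e }) ,
    single-∈
  path-DSP {u = u} (cons {w = w} e ω@(cons _ ω′)) uq@(_ ∷ uq′) u≢v
    with Q , D , ι , V ← path-DSP ω uq′ (λ { refl → Unique[x∷xs]⇒x∉xs uq′ (sink∈ ω′) }) =
    ⟨ u , w ⟩ ∪ Q ,
    serDSP (edgeDSP (head≢ uq)) D (λ x i j →
      [ (λ { refl → ⊥-elim (Unique[x∷xs]⇒x∉xs uq (V j)) }) , id ]′ (single-vtx i)) ,
    (λ { _ _ (inj₁ (refl , refl)) → e ; x y (inj₂ q) → ι x y q }) ,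
    λ i → [ single-∈ , there ∘ V ]′ (vtx-∪ {H = ⟨ u , w ⟩} {K = Q} i)

  walk? : (E : Fin n → Fin n → Bool) → ∀ xs u v → Dec (Walk E xs u v)
  walk? E [] u v = no λ ()
  walk? E (x ∷ []) u v = Dec.map′ (λ { (refl , refl) → one _ }) (λ { (one _) → refl , refl })
    ((x ≟ u) ×-dec (x ≟ v))
  walk? E (x ∷ y ∷ xs) u v = Dec.map′ (λ { (refl , e , ω) → cons e ω }) (λ { (cons e ω) → refl , e , ω })
    ((x ≟ u) ×-dec (E x y Bool.≟ true) ×-dec walk? E (y ∷ xs) y v)

  path? : (E : Fin n → Fin n → Bool) → ∀ u v xs → Dec (Path E xs u v)
  path? E u v xs = walk? E xs u v ×-dec unique? _≟_ xs

  follow-path : DSP H s t → H ⊑ edges E → Path E xs s t →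
                WSubdivision E ⊎ Extension E H s t (Consecutive xs)
  follow-path D ι (one _ , _) = ⊥-elim (source≢sink D refl)
  follow-path D ι (ω@(cons _ _) , uq) = follow D ι (source-vtx D) nil ω uq

  follow-all : (xss : List (List (Fin n))) → DSP H s t → H ⊑ edges E →
               WSubdivision E ⊎
               Extension E H s t (λ x y → ∃ λ xs → xs ∈ xss × Path E xs s t × Consec x y xs)
  follow-all [] D ι = inj₂ (mkExt D ι (λ _ _ h → h) λ { _ _ (_ , () , _) })
  follow-all {s = s} {t = t} {E = E} (xs ∷ xss) D ι with path? E s t xs
  ... | no ¬p = Sum.map₂
    (λ { (mkExt D′ ι′ g f) → mkExt D′ ι′ g λ
      { _ _ (_ , here refl , p , _) → ⊥-elim (¬p p)
      ; x y (zs , there i , p , h) → f x y (zs , i , p , h) } })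
    (follow-all xss D ι)
  ... | yes p = [ inj₁ , (λ (mkExt D₁ ι₁ g₁ f₁) → Sum.map₂
    (λ { (mkExt D′ ι′ g f) → mkExt D′ ι′ (⊑-trans g₁ g) λ
      { x y (_ , here refl , _ , h) → g x y (f₁ x y h)
      ; x y (zs , there i , p , h) → f x y (zs , i , p , h) } })
    (follow-all xss D₁ ι₁)) ]′ (follow-path D ι p)

  lookup-injective : Unique xs → ∀ {i j} → lookup xs i ≡ lookup xs j → i ≡ j
  lookup-injective (_ ∷ _) {zero} {zero} _ = refl
  lookup-injective uq@(_ ∷ _) {zero} {suc j} eq =
    ⊥-elim (Unique[x∷xs]⇒x∉xs uq (subst (_∈ _) (sym eq) (∈-lookup j)))
  lookup-injective uq@(_ ∷ _) {suc i} {zero} eq =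
    ⊥-elim (Unique[x∷xs]⇒x∉xs uq (subst (_∈ _) eq (∈-lookup i)))
  lookup-injective (_ ∷ uq) {suc i} {suc j} eq = cong suc (lookup-injective uq eq)

  listsUpTo : ℕ → List (List (Fin n))
  listsUpTo zero = [] ∷ []
  listsUpTo (suc k) = [] ∷ cartesianProductWith _∷_ (allFin n) (listsUpTo k)

  ∈-listsUpTo : ∀ k xs → length xs ≤ k → xs ∈ listsUpTo k
  ∈-listsUpTo zero [] _ = here refl
  ∈-listsUpTo (suc k) [] _ = here refl
  ∈-listsUpTo (suc k) (x ∷ xs) (s≤s le) =
    there (∈-cartesianProductWith⁺ _∷_ (∈-allFin x) (∈-listsUpTo k xs le))

  -- The positions of a list without repetitions embed into `Fin n`, which bounds its length by `n`.
  unique∈listsUpTo : Unique xs → xs ∈ listsUpTo n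
  unique∈listsUpTo {xs = xs} uq = ∈-listsUpTo n xs (injective⇒≤ (lookup-injective uq))

  no-consec-closed : Path E xs s s → ¬ Consec x y xs
  no-consec-closed (one _ , _) (there ())
  no-consec-closed (cons _ ω , uq) _ = Unique[x∷xs]⇒x∉xs uq (sink∈ ω)

  DSP-from-path : s ≢ t → Path E xs s t → Σ (ERel n) λ Q → DSP Q s t × Q ⊑ edges E
  DSP-from-path s≢t (one _ , _) = ⊥-elim (s≢t refl)
  DSP-from-path s≢t (ω@(cons _ _) , uq) with Q , D , ι , _ ← path-DSP ω uq s≢t = Q , D , ι

  -- All path edges have been absorbed; conversely, by `path-through`, every edge of the final graph
  -- lies on a source-sink path of `E`. So the final graph is exactly `PG E s t`.
  extension-PG : Extension E H s t (λ x y → ∃ λ xs → xs ∈ listsUpTo n × Path E xs s t × Consec x y xs) →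
                 DSP (PG E s t) s t
  extension-PG (mkExt D ι _ f) = DSP-resp
    (λ x y → mk⇔ (λ { (xs , p , h) → f x y (xs , unique∈listsUpTo (proj₂ p) , p , h) })
                 (λ h → let p , k = path-through D ι h in verts p , path p , k))
    D

  path⇒DSP-PG : ¬ WSubdivision E → s ≢ t → Path E xs s t → DSP (PG E s t) s t
  path⇒DSP-PG ¬W s≢t p =
    let _ , D , ι = DSP-from-path s≢t p in
    [ (λ X → ⊥-elim (¬W X)) , extension-PG ]′ (follow-all (listsUpTo n) D ι)

  W-free⇒P1 : (E : Fin n → Fin n → Bool) → ¬ WSubdivision E → P1 E
  W-free⇒P1 E ¬W s t with s ≟ t | Any.any? (path? E s t) (listsUpTo n)
  ... | yes refl | _ = inj₂ λ { x y (xs , p , h) → no-consec-closed p h }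
  ... | no s≢t | no ¬p = inj₂ λ { x y (xs , p , h) → ¬p (lose (unique∈listsUpTo (proj₂ p)) p) }
  ... | no s≢t | yes ∃p = inj₁ (path⇒DSP-PG ¬W s≢t (proj₂ (satisfied ∃p)))

  -- Series-parallel graphs contain no subdivision of W between their terminals.

  edge-at-source : Walk E xs u v → u ≢ v → Vtx (Consecutive xs) u
  edge-at-source (one _) u≢v = ⊥-elim (u≢v refl)
  edge-at-source (cons _ _) _ = tail-of here

  last-edge : Walk E (w ∷ xs) w v → Vtx (Consecutive (u ∷ w ∷ xs)) v
  last-edge (one _) = head-of here
  last-edge (cons _ ω) with last-edge ω
  ... | tail-of h = tail-of (there h)
  ... | head-of h = head-of (there h)

  edge-at-sink : Walk E xs u v → u ≢ v → Vtx (Consecutive xs) v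
  edge-at-sink (one _) u≢v = ⊥-elim (u≢v refl)
  edge-at-sink (cons _ ω) _ = last-edge ω

  second-internal : Unique (u ∷ w ∷ x ∷ xs) → Walk E (x ∷ xs) x v → Internal w (u ∷ w ∷ x ∷ xs) u v
  second-internal uq@(_ ∷ uq′) ω =
    there (here refl) , ≢-sym (head≢ uq) , λ { refl → Unique[x∷xs]⇒x∉xs uq′ (sink∈ ω) }

  -- Two consecutive edges in different parts would meet in `s` or `t`, but they meet in an inner
  -- vertex of the path.
  monochrome : MeetAt₂ H₁ H₂ s t → Path E xs u v → Consecutive xs ⊑ H₁ ∪ H₂ →
               (∀ {x} → Internal x xs u v → x ≢ s × x ≢ t) →
               Consecutive xs ⊑ H₁ ⊎ Consecutive xs ⊑ H₂
  monochrome mt (one _ , _) f inner = inj₁ λ { _ _ (there ()) }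
  monochrome mt (cons _ (one _) , _) f inner with f _ _ here
  ... | inj₁ h = inj₁ λ { _ _ here → h ; _ _ (there (there ())) }
  ... | inj₂ h = inj₂ λ { _ _ here → h ; _ _ (there (there ())) }
  monochrome mt (cons {w = w} _ ω@(cons _ ω′) , uq@(_ ∷ uq′)) f inner
    with f _ _ here | monochrome mt (ω , uq′) (λ x y → f x y ∘ there)
           (λ (i , _ , x≢v) → inner (there i , (λ { refl → Unique[x∷xs]⇒x∉xs uq i }) , x≢v))
  ... | inj₁ h | inj₁ g = inj₁ λ { _ _ here → h ; x y (there k) → g x y k }
  ... | inj₂ h | inj₂ g = inj₂ λ { _ _ here → h ; x y (there k) → g x y k }
  ... | inj₁ h | inj₂ g = ⊥-elim
    ([ proj₁ (inner (second-internal uq ω′)) , proj₂ (inner (second-internal uq ω′)) ]′ (mt _ (head-of h) (tail-of (g _ _ here))))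
  ... | inj₂ h | inj₁ g = ⊥-elim
    ([ proj₁ (inner (second-internal uq ω′)) , proj₂ (inner (second-internal uq ω′)) ]′ (mt _ (tail-of (g _ _ here)) (head-of h)))

  -- The first edge in `H₂` starts at a vertex of `H₁`; if there is no such edge, the last vertex
  -- lies in both parts.
  crosses : MeetAt H₁ H₂ m → Walk E xs u v → Consecutive xs ⊑ H₁ ∪ H₂ →
            Vtx H₁ u → Vtx H₂ v → m ∈ xs
  crosses mt (one _) f i j with refl ← mt _ i j = here refl
  crosses mt (cons _ ω) f i j with f _ _ here
  ... | inj₁ h = there (crosses mt ω (λ x y → f x y ∘ there) (head-of h) j)
  ... | inj₂ h with refl ← mt _ i (tail-of h) = here refl

  consec-⋈⁻ : Walk E xs u m → Walk E ys m v → Consecutive (xs ⋈ ys) ⊑ Consecutive xs ∪ Consecutive ys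
  consec-⋈⁻ (one _) (one _) _ _ h = inj₂ h
  consec-⋈⁻ (one _) (cons _ _) _ _ h = inj₂ h
  consec-⋈⁻ (cons _ ω) ω′ _ _ here = inj₁ here
  consec-⋈⁻ (cons _ ω) ω′ x y (there h) = Sum.map₁ there (consec-⋈⁻ ω ω′ x y h)

  module _ (X : WSubdivision E) where
    open WSubdivision X renaming (path to leg)

    private
      walkOf : ∀ e → Walk E (leg e) (branch (tail e)) (branch (head e))
      walkOf e = proj₁ (isPath e)

      branch≢ : ∀ {p q} → p ≢ q → branch p ≢ branch q
      branch≢ p≢q eq = p≢q (injective _ _ eq)

      shared : ∀ e e′ → e ≢ e′ → x ∈ leg e → x ∈ leg e′ → x ≡ branch (tail e) ⊎ x ≡ branch (head e)
      shared {x = x} e e′ e≢e′ i j with x ≟ branch (tail e) | x ≟ branch (head e)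
      ... | yes eq | _ = inj₁ eq
      ... | no _ | yes eq = inj₂ eq
      ... | no ≢tail | no ≢head = ⊥-elim (disjoint e e′ e≢e′ _ (i , ≢tail , ≢head) j)

      inner≢source : ∀ e → Internal x (leg e) (branch (tail e)) (branch (head e)) → x ≢ branch a
      inner≢source ab (_ , ≢a , _) = ≢a
      inner≢source ac (_ , ≢a , _) = ≢a
      inner≢source bd i refl = disjoint bd ab (λ ()) _ i (source∈ (walkOf ab))
      inner≢source cd i refl = disjoint cd ab (λ ()) _ i (source∈ (walkOf ab))
      inner≢source bc i refl = disjoint bc ab (λ ()) _ i (source∈ (walkOf ab))

      inner≢sink : ∀ e → Internal x (leg e) (branch (tail e)) (branch (head e)) → x ≢ branch d
      inner≢sink ab i refl = disjoint ab bd (λ ()) _ i (sink∈ (walkOf bd))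
      inner≢sink ac i refl = disjoint ac bd (λ ()) _ i (sink∈ (walkOf bd))
      inner≢sink bd (_ , _ , ≢d) = ≢d
      inner≢sink cd (_ , _ , ≢d) = ≢d
      inner≢sink bc i refl = disjoint bc bd (λ ()) _ i (sink∈ (walkOf bd))

      tail≢head : ∀ e → tail e ≢ head e
      tail≢head ab ()
      tail≢head ac ()
      tail≢head bd ()
      tail≢head cd ()
      tail≢head bc ()

      at-tail : ∀ e → Vtx (Consecutive (leg e)) (branch (tail e))
      at-tail e = edge-at-source (walkOf e) (branch≢ (tail≢head e))

      at-head : ∀ e → Vtx (Consecutive (leg e)) (branch (head e))
      at-head e = edge-at-sink (walkOf e) (branch≢ (tail≢head e))

      Carries : ERel n → Set
      Carries H = ∀ e → Consecutive (leg e) ⊑ H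

      -- Each other leg shares the corner `b` or `c` with the leg `bc`, and the two parts may not
      -- share such a corner.
      one-side : MeetAt₂ H₁ H₂ (branch a) (branch d) →
                 (∀ e → Consecutive (leg e) ⊑ H₁ ⊎ Consecutive (leg e) ⊑ H₂) →
                 Consecutive (leg bc) ⊑ H₁ → Carries H₁
      one-side {H₁ = H₁} {H₂ = H₂} mt colour g = λ
        { ab → same ab (at-tail bc) (at-head ab) (branch≢ λ ()) (branch≢ λ ())
        ; ac → same ac (at-head bc) (at-head ac) (branch≢ λ ()) (branch≢ λ ())
        ; bd → same bd (at-tail bc) (at-tail bd) (branch≢ λ ()) (branch≢ λ ())
        ; cd → same cd (at-head bc) (at-tail cd) (branch≢ λ ()) (branch≢ λ ())
        ; bc → g }
        where
        same : ∀ e → Vtx (Consecutive (leg bc)) x → Vtx (Consecutive (leg e)) x →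
               x ≢ branch a → x ≢ branch d → Consecutive (leg e) ⊑ H₁
        same e i j ≢a ≢d with colour e
        ... | inj₁ f = f
        ... | inj₂ f = ⊥-elim ([ ≢a , ≢d ]′ (mt _ (vtx-mono g i) (vtx-mono f j)))

    DSP-no-W : DSP H (branch a) (branch d) → (∀ e → Consecutive (leg e) ⊑ H) → ⊥
    DSP-no-W (single _ f) carries
      with single-vtx (vtx-mono (λ x y → to (f x y)) (vtx-mono (carries ab) (at-head ab)))
    ... | inj₁ eq = branch≢ (λ ()) eq
    ... | inj₂ eq = branch≢ (λ ()) eq
    DSP-no-W (par H₁ H₂ D₁ D₂ f _ mt) carries =
      [ DSP-no-W D₁ ∘ one-side {H₂ = H₂} mt colour
      , DSP-no-W D₂ ∘ one-side {H₂ = H₁} (meetAt₂-sym {H = H₁} {K = H₂} mt) (swap ∘ colour) ]′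
      (colour bc)
      where
      colour : ∀ e → Consecutive (leg e) ⊑ H₁ ⊎ Consecutive (leg e) ⊑ H₂
      colour e = monochrome mt (isPath e) (⊑-trans (carries e) (λ x y → to (f x y)))
        λ i → inner≢source e i , inner≢sink e i
    DSP-no-W (ser m H₁ H₂ D₁ D₂ f mt) carries = branch≢ (λ ()) (trans (sym m≡b) m≡c)
      where
      carried : ∀ e → Consecutive (leg e) ⊑ H₁ ∪ H₂
      carried e = ⊑-trans (carries e) (λ x y → to (f x y))
      m∈b-route : m ∈ leg ab ⊎ m ∈ leg bd
      m∈b-route = ∈-⋈⁻ (leg ab) (leg bd) (crosses mt (walk-⋈ (walkOf ab) (walkOf bd))
        (⊑-trans (consec-⋈⁻ (walkOf ab) (walkOf bd)) (∪-⊑ (carried ab) (carried bd)))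
        (source-vtx D₁) (sink-vtx D₂))
      m∈c-route : m ∈ leg ac ⊎ m ∈ leg cd
      m∈c-route = ∈-⋈⁻ (leg ac) (leg cd) (crosses mt (walk-⋈ (walkOf ac) (walkOf cd))
        (⊑-trans (consec-⋈⁻ (walkOf ac) (walkOf cd)) (∪-⊑ (carried ac) (carried cd)))
        (source-vtx D₁) (sink-vtx D₂))
      not-a : ∀ {A : Set} → m ≡ branch a → A
      not-a eq = ⊥-elim (source≢sink D₁ (sym eq))
      not-d : ∀ {A : Set} → m ≡ branch d → A
      not-d eq = ⊥-elim (source≢sink D₂ eq)
      -- Legs of different routes share at most their ends, so `m` is an end of its leg on the
      -- `b`-route. As it is neither terminal, it is `b`; likewise it is `c`.
      m≡b : m ≡ branch b
      m≡b with m∈b-route | m∈c-route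
      ... | inj₁ i | inj₁ j = [ not-a , id ]′ (shared ab ac (λ ()) i j)
      ... | inj₁ i | inj₂ j = [ not-a , id ]′ (shared ab cd (λ ()) i j)
      ... | inj₂ i | inj₁ j = [ id , not-d ]′ (shared bd ac (λ ()) i j)
      ... | inj₂ i | inj₂ j = [ id , not-d ]′ (shared bd cd (λ ()) i j)
      m≡c : m ≡ branch c
      m≡c with m∈b-route | m∈c-route
      ... | inj₁ i | inj₁ j = [ not-a , id ]′ (shared ac ab (λ ()) j i)
      ... | inj₁ i | inj₂ j = [ id , not-d ]′ (shared cd ab (λ ()) j i)
      ... | inj₂ i | inj₁ j = [ not-a , id ]′ (shared ac bd (λ ()) j i)
      ... | inj₂ i | inj₂ j = [ id , not-d ]′ (shared cd bd (λ ()) j i)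

    -- The legs of W on source-sink paths.

    private
      -- A common vertex is an end of both legs, and the tail of `e` is no end of `e′`.
      meets : ∀ e e′ → e ≢ e′ → branch (tail e) ≢ branch (head e′) → branch (tail e) ≢ branch (tail e′) →
              branch (head e) ≢ branch (head e′) → Meet (leg e) (leg e′) (branch (head e))
      meets e e′ e≢e′ tail≢head′ tail≢tail′ head≢head′ i j
        with shared e e′ e≢e′ i j | shared e′ e (e≢e′ ∘ sym) j i
      ... | inj₂ eq | _ = eq
      ... | inj₁ refl | inj₁ eq = ⊥-elim (tail≢tail′ eq)
      ... | inj₁ refl | inj₂ eq = ⊥-elim (tail≢head′ eq)

    -- The routes `abd`, `acd` and `abcd` cover all five legs.
    W-carried-by-PG : ∀ e → Consecutive (leg e) ⊑ PG E (branch a) (branch d)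
    W-carried-by-PG = λ
      { ab _ _ h → _ , abd , consec-⋈ˡ {ys = leg bd} h
      ; ac _ _ h → _ , acd , consec-⋈ˡ {ys = leg cd} h
      ; bd _ _ h → _ , abd , consec-⋈ʳ (walkOf ab) (walkOf bd) h
      ; cd _ _ h → _ , acd , consec-⋈ʳ (walkOf ac) (walkOf cd) h
      ; bc _ _ h → _ , abcd , consec-⋈ˡ {ys = leg cd} (consec-⋈ʳ (walkOf ab) (walkOf bc) h) }
      where
      abd = path-⋈ (isPath ab) (isPath bd) (meets ab bd (λ ()) (branch≢ λ ()) (branch≢ λ ()) (branch≢ λ ()))
      acd = path-⋈ (isPath ac) (isPath cd) (meets ac cd (λ ()) (branch≢ λ ()) (branch≢ λ ()) (branch≢ λ ()))
      abc = path-⋈ (isPath ab) (isPath bc) (meets ab bc (λ ()) (branch≢ λ ()) (branch≢ λ ()) (branch≢ λ ()))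
      -- These two legs are in fact disjoint; `Meet` at `c` is the form needed for joining `cd` at
      -- `c`.
      ab∩cd : Meet (leg ab) (leg cd) (branch c)
      ab∩cd i j with shared ab cd (λ ()) i j | shared cd ab (λ ()) j i
      ... | _ | inj₁ eq = eq
      ... | inj₁ refl | inj₂ eq = ⊥-elim (branch≢ (λ ()) eq)
      ... | inj₂ refl | inj₂ eq = ⊥-elim (branch≢ (λ ()) eq)
      abcd = path-⋈ abc (isPath cd) λ i j →
        [ (λ k → ab∩cd k j)
        , (λ k → meets bc cd (λ ()) (branch≢ λ ()) (branch≢ λ ()) (branch≢ λ ()) k j) ]′
        (∈-⋈⁻ (leg ab) (leg bc) i)

    W⇒¬P1 : ¬ P1 E
    W⇒¬P1 p with p (branch a) (branch d)
    ... | inj₁ D = DSP-no-W D W-carried-by-PG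
    ... | inj₂ none with at-tail ab
    ...   | tail-of h = none _ _ (W-carried-by-PG ab _ _ h)
    ...   | head-of h = none _ _ (W-carried-by-PG ab _ _ h)

theorem3 : (n : ℕ) (E : Fin n → Fin n → Bool) → (∀ x → E x x ≡ false) →
    (P1 E ⇔ (¬ WSubdivision E))
theorem3 n E _ = mk⇔ (λ p X → W⇒¬P1 X p) (W-free⇒P1 E)
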